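{- Let $q$ be a prime power and let $n=q^2+q+1$. Then the code $\mathcal{D}\subseteq \mathrm{U}(n,\mathbb{F}_q)$ given by Construction C (described in the context, for any admissible choice of the points $P_i$, $Q_i$ and representatives $u_i$, $v_i$) is a non-trivial perfect linear flag-rank-metric code with minimum distance $3$ and codimension $3$.
   Context: $\mathbb{F}_q$ is the finite field with $q$ elements. $\mathrm{U}(n,\mathbb{F}_q)$ is the $\mathbb{F}_q$-vector space of $n\times n$ upper triangular matrices over $\mathbb{F}_q$; it has dimension $\frac{n(n+1)}{2}$. For $M\in \mathrm{U}(n,\mathbb{F}_q)$ and $1\le i\le n$, $M_{[i]}$ is the $i\times(n-i+1)$ submatrix of $M$ obtained by deleting the first $i-1$ columns and the last $n-i$ rows (i.e. rows $1,\dots,i$ and columns $i,\dots,n$). The flag-rank weight of $M$ is $\mathrm{fr}(M)=\sum_{i=1}^{n}\mathrm{rk}(M_{[i]})$; the flag-rank distance is $\mathrm{d}_{\mathrm{fr}}(A,B)=\mathrm{fr}(A-B)$. A linear flag-rank-metric code is an $\mathbb{F}_q$-subspace $\mathcal{C}$ of $\mathrm{U}(n,\mathbb{F}_q)$; its minimum (flag-rank) distance, defined when $\mathcal{C}\neq\{\boldsymbol{0}\}$, is $\delta=\min\{\mathrm{fr}(M):M\in\mathcal{C}\setminus\{\boldsymbol{0}\}\}$. Its codimension is $\frac{n(n+1)}{2}-\dim_{\mathbb{F}_q}(\mathcal{C})$. Let $b_q(n,t)=|\{A\in \mathrm{U}(n,\mathbb{F}_q):\mathrm{fr}(A)\le t\}|$.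 A code $\mathcal{C}$ with minimum distance $\delta$ is perfect if $|\mathcal{C}|\,b_q(n,t)=q^{\frac{n(n+1)}{2}}$, where $t=\left\lfloor\frac{\delta-1}{2}\right\rfloor$; it is non-trivial if $\mathcal{C}\ne \mathrm{U}(n,\mathbb{F}_q)$. Construction C. Let $3\le n\le q^2+q+1$. Let $D_2(n,\mathbb{F}_q)=\{A\in \mathrm{U}(n,\mathbb{F}_q): a_{i,j}=0 \text{ whenever } j-i\ge 2\}$, and identify it with $\mathbb{F}_q^{2n-1}$ via the linear isomorphism \[ \rho\left(\sum_{i=1}^{n}\lambda_iE_i+\sum_{i=1}^{n-1}\mu_iF_i\right)=(\lambda_1,\mu_1,\lambda_2,\ldots,\mu_{n-1},\lambda_n), \] where $E_i$ (resp. $F_i$) is the matrix with entry $1$ in position $(i,i)$ (resp. $(i,i+1)$) and $0$ elsewhere. Let $\mathrm{PG}(2,q)$ be the projective plane with underlying vector space $\mathbb{F}_q^3$, and write $[u]$ for the point spanned by a nonzero vector $u$. Choose distinct points $P_i=[u_i]\in\mathrm{PG}(2,q)$ for $i=1,\dots,n$, and points $Q_i=[v_i]\in\mathrm{PG}(2,q)$ with $Q_i\notin\langle P_i,P_{i+1}\rangle$ (the line through $P_i$ and $P_{i+1}$) for $i=1,\dots,n-1$. Let $H=(u_1\mid v_1\mid u_2\mid v_2\mid\cdots\mid v_{n-1}\mid u_n)$ be the $3\times(2n-1)$ matrix over $\mathbb{F}_q$ with these columns, let $D=\ker(H)=\{x\in\mathbb{F}_q^{2n-1}:Hx^{\top}=0\}$,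 and define \[ \mathcal{D}:=\rho^{ -1}(D)\oplus \overline{U}(n-2,\mathbb{F}_q)\subseteq \mathrm{U}(n,\mathbb{F}_q), \] where $\overline{U}(n-2,\mathbb{F}_q)=\{A\in \mathrm{U}(n,\mathbb{F}_q): a_{i,j}=0 \text{ unless } j-i\ge 2\}$ is the space of matrices supported on the diagonals strictly above the first superdiagonal. -}

module Defs where

open import Algebra.Apartness.Bundles using (HeytingField; HeytingCommutativeRing)
open import Algebra.Bundles using (CommutativeRing)
open import Algebra.Module.Bundles using (Module)
open import Algebra.Module.Construct.TensorUnit using (⟨module⟩)
import Algebra.Module.Properties.Semimodule as SemimoduleProperties
import Algebra.Properties.CommutativeMonoid.Sum as CommutativeMonoidSum
import Algebra.Properties.Monoid.Sum as MonoidSum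
open import Data.Fin.Base as Fin
  using (Fin; zero; suc; toℕ; inject₁; inject≤; _↑ʳ_; funToFin; finToFun)
open import Data.Fin.Properties as Fin
  using (toℕ<n; toℕ≤n; finToFun-funToFin)
open import Data.Nat.Base as ℕ using (ℕ; zero; suc; _∸_; _^_; _≤_; _<_)
open import Data.Nat.DivMod using (_/_)
open import Data.Nat.Primality using (Prime)
open import Data.Nat.Properties using (m+[n∸m]≡n; +-0-monoid)
open import Data.Product.Base using (∃; ∃-syntax; Σ-syntax; _×_; _,_; proj₁)
open import Data.Sum.Base using (_⊎_; inj₁; inj₂)
open import Data.Vec.Functional using (Vector; []; _∷_; head; tail)
open import Function.Base using (_∘_)
open import Function.Bundles using (Inverse)
open import Function.Properties.Inverse using (Inverse⇒Injection)
open import Level using (_⊔_)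
import Level
open import Relation.Binary.Bundles using (Setoid)
import Relation.Binary.Construct.On as On
open import Relation.Binary.Definitions using (Decidable)
open import Relation.Binary.PropositionalEquality as ≡ using (_≡_; _≢_)
import Relation.Binary.Reasoning.Setoid as ≈-Reasoning
open import Relation.Nullary.Decidable using (Dec; yes; no; map′; via-injection)
open import Relation.Nullary.Negation using (¬_; contradiction)
open import Relation.Unary using (Pred; _∈_; _∉_; _⊆_; _≐_)

IsPrimePower : ℕ → Set
IsPrimePower q = ∃[ p ] ∃[ k ] Prime p × 1 ≤ k × q ≡ p ^ k

HasCardinality : ∀ {a ℓ} → Setoid a ℓ → ℕ → Set (a ⊔ ℓ)
HasCardinality S k = Inverse S (≡.setoid (Fin k))

-- Over a finite carrier equality and invertibility are decidable, so the
-- apartness of a Heyting field is just the negation of equality.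
record FiniteField c ℓ₁ ℓ₂ (q : ℕ) : Set (Level.suc (c ⊔ ℓ₁ ⊔ ℓ₂)) where
  field
    heytingField : HeytingField c ℓ₁ ℓ₂

  commutativeRing : CommutativeRing c ℓ₁
  commutativeRing = HeytingCommutativeRing.commutativeRing
    (HeytingField.heytingCommutativeRing heytingField)

  field
    cardinality : HasCardinality (CommutativeRing.setoid commutativeRing) q

module _ {r ℓr} {R : CommutativeRing r ℓr} where

  pointwise : ∀ {a v ℓv} → Set a → Module R v ℓv → Module R (a ⊔ v) (a ⊔ ℓv)
  pointwise A V = record
    { Carrierᴹ = A → Carrierᴹ
    ; _≈ᴹ_ = λ f g → ∀ x → f x ≈ᴹ g x
    ; _+ᴹ_ = λ f g x → f x +ᴹ g x
    ; _*ₗ_ = λ s f x → s *ₗ f x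
    ; _*ᵣ_ = λ f s x → f x *ᵣ s
    ; 0ᴹ = λ _ → 0ᴹ
    ; -ᴹ_ = λ f x → -ᴹ f x
    ; isModule = record
      { isBimodule = record
        { isBisemimodule = record
          { +ᴹ-isCommutativeMonoid = record
            { isMonoid = record
              { isSemigroup = record
                { isMagma = record
                  { isEquivalence = record
                    { refl = λ _ → ≈ᴹ-refl
                    ; sym = λ p x → ≈ᴹ-sym (p x)
                    ; trans = λ p q x → ≈ᴹ-trans (p x) (q x)
                    }
                  ; ∙-cong = λ p q x → +ᴹ-cong (p x) (q x)
                  }
                ; assoc = λ f g h x → +ᴹ-assoc (f x) (g x) (h x)
                }
              ; identity = (λ f x → +ᴹ-identityˡ (f x)) , (λ f x → +ᴹ-identityʳ (f x))
              }
            ; comm = λ f g x → +ᴹ-comm (f x) (g x)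
            }
          ; isPreleftSemimodule = record
            { *ₗ-cong = λ s p x → *ₗ-cong s (p x)
            ; *ₗ-zeroˡ = λ f x → *ₗ-zeroˡ (f x)
            ; *ₗ-distribʳ = λ f s t x → *ₗ-distribʳ (f x) s t
            ; *ₗ-identityˡ = λ f x → *ₗ-identityˡ (f x)
            ; *ₗ-assoc = λ s t f x → *ₗ-assoc s t (f x)
            ; *ₗ-zeroʳ = λ s x → *ₗ-zeroʳ s
            ; *ₗ-distribˡ = λ s f g x → *ₗ-distribˡ s (f x) (g x)
            }
          ; isPrerightSemimodule = record
            { *ᵣ-cong = λ p s x → *ᵣ-cong (p x) s
            ; *ᵣ-zeroʳ = λ f x → *ᵣ-zeroʳ (f x)
            ; *ᵣ-distribˡ = λ f s t x → *ᵣ-distribˡ (f x) s t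
            ; *ᵣ-identityʳ = λ f x → *ᵣ-identityʳ (f x)
            ; *ᵣ-assoc = λ f s t x → *ᵣ-assoc (f x) s t
            ; *ᵣ-zeroˡ = λ s x → *ᵣ-zeroˡ s
            ; *ᵣ-distribʳ = λ s f g x → *ᵣ-distribʳ s (f x) (g x)
            }
          ; *ₗ-*ᵣ-assoc = λ s f t x → *ₗ-*ᵣ-assoc s (f x) t
          }
        ; -ᴹ‿cong = λ p x → -ᴹ‿cong (p x)
        ; -ᴹ‿inverse = (λ f x → -ᴹ‿inverseˡ (f x)) , (λ f x → -ᴹ‿inverseʳ (f x))
        }
      ; *ₗ-*ᵣ-coincident = λ s f x → *ₗ-*ᵣ-coincident s (f x)
      }
    }
    where open Module V

  module LinearAlgebra {v ℓv} (V : Module R v ℓv) where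
    open CommutativeRing R using (Carrier; _≈_; 0#)
    open Module V
    open MonoidSum +ᴹ-monoid using (sum)

    combination : ∀ {k} → Vector Carrier k → Vector Carrierᴹ k → Carrierᴹ
    combination c b = sum (λ i → c i *ₗ b i)

    Span : ∀ {k} → Vector Carrierᴹ k → Pred Carrierᴹ (r ⊔ ℓv)
    Span b x = ∃[ c ] combination c b ≈ᴹ x

    LinearlyIndependent : ∀ {k} → Vector Carrierᴹ k → Set (r ⊔ ℓr ⊔ ℓv)
    LinearlyIndependent b = ∀ c → combination c b ≈ᴹ 0ᴹ → ∀ i → c i ≈ 0#

    record IsSubspace {p} (S : Pred Carrierᴹ p) : Set (r ⊔ v ⊔ ℓv ⊔ p) where
      field
        resp     : ∀ {x y} → x ≈ᴹ y → x ∈ S → y ∈ S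
        0-closed : 0ᴹ ∈ S
        +-closed : ∀ {x y} → x ∈ S → y ∈ S → (x +ᴹ y) ∈ S
        *-closed : ∀ s {x} → x ∈ S → (s *ₗ x) ∈ S

    HasDimension : ∀ {p} → Pred Carrierᴹ p → ℕ → Set (r ⊔ ℓr ⊔ v ⊔ ℓv ⊔ p)
    HasDimension S d =
      Σ[ b ∈ Vector Carrierᴹ d ] LinearlyIndependent b × Span b ≐ S

    -- Elements are counted up to ≈ᴹ.
    HasSize : ∀ {p} → Pred Carrierᴹ p → ℕ → Set (v ⊔ ℓv ⊔ p)
    HasSize S = HasCardinality (On.setoid ≈ᴹ-setoid (proj₁ {B = S}))

    infixl 6 _⊕_
    _⊕_ : ∀ {p p′} → Pred Carrierᴹ p → Pred Carrierᴹ p′ → Pred Carrierᴹ (v ⊔ ℓv ⊔ p ⊔ p′)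
    (S ⊕ T) x = ∃[ y ] ∃[ z ] y ∈ S × z ∈ T × x ≈ᴹ y +ᴹ z

module FiniteDimension {c ℓ₁ ℓ₂ q} (𝔽 : FiniteField c ℓ₁ ℓ₂ q) where
  open FiniteField 𝔽
  open CommutativeRing commutativeRing hiding (zero)
  open HeytingField heytingField using (tight; #⇒invertible)
  private module Enum = Inverse cardinality

  infix 4 _≟_
  _≟_ : Decidable _≈_
  _≟_ = via-injection (Inverse⇒Injection cardinality) Fin._≟_

  anyVector? : ∀ {p} k {P : Pred (Vector Carrier k) p} →
    (∀ {c d} → (∀ i → c i ≈ d i) → P c → P d) →
    (∀ c → Dec (P c)) → Dec (∃ P)
  anyVector? k {P} resp P? = map′ (λ (a , p) → decode a , p) encode
                                  (Fin.any? (P? ∘ decode))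
    where
    decode : Fin (q ^ k) → Vector Carrier k
    decode a i = Enum.from (finToFun {q} {k} a i)

    encode : ∃ P → ∃ (P ∘ decode)
    encode (c , p) = funToFin (Enum.to ∘ c) , resp
      (λ i → sym (Enum.inverseʳ (finToFun-funToFin (Enum.to ∘ c) i))) p

  zero-or-unit : ∀ x → x ≈ 0# ⊎ ∃[ y ] y * x ≈ 1#
  zero-or-unit x with anyVector? 1 {λ c → head c * x ≈ 1#}
    (λ c≈d p → trans (*-congʳ (sym (c≈d zero))) p) (λ c → head c * x ≟ 1#)
  ... | yes (c , p) = inj₂ (head c , p)
  ... | no ¬unit = inj₁ (proj₁ (tight x 0#) λ x#0 →
    let (y , y*[x-0]≈1 , _) = #⇒invertible x#0
    in ¬unit ((y ∷ []) , trans (*-congˡ (sym x-0≈x)) y*[x-0]≈1))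
    where
    x-0≈x : x + - 0# ≈ x
    x-0≈x = trans (+-congˡ (trans (sym (+-identityˡ (- 0#))) (-‿inverseʳ 0#)))
                  (+-identityʳ x)

  module _ {v ℓv} (V : Module commutativeRing v ℓv)
           (_≟ᴹ_ : Decidable (Module._≈ᴹ_ V)) where
    open Module V
    open LinearAlgebra V
    open CommutativeMonoidSum +ᴹ-commutativeMonoid
      using (sum; sum-cong-≋; ∑-distrib-+)
    open SemimoduleProperties semimodule using (x≈0⇒x*y≈0)
    open ≈-Reasoning ≈ᴹ-setoid

    private
      combination-congˡ : ∀ {k} {c d : Vector Carrier k} b → (∀ i → c i ≈ d i) →
        combination c b ≈ᴹ combination d b
      combination-congˡ b c≈d = sum-cong-≋ (λ i → *ₗ-congʳ (c≈d i))

      combination-+ : ∀ {k} (c d : Vector Carrier k) b →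
        combination (λ i → c i + d i) b ≈ᴹ combination c b +ᴹ combination d b
      combination-+ c d b = ≈ᴹ-trans
        (sum-cong-≋ (λ i → *ₗ-distribʳ (b i) (c i) (d i)))
        (∑-distrib-+ (λ i → c i *ₗ b i) (λ i → d i *ₗ b i))

      combination-* : ∀ {k} s (c : Vector Carrier k) b →
        combination (λ i → s * c i) b ≈ᴹ s *ₗ combination c b
      combination-* {zero}  s c b = ≈ᴹ-sym (*ₗ-zeroʳ s)
      combination-* {suc k} s c b = ≈ᴹ-trans
        (+ᴹ-cong (*ₗ-assoc s (c zero) (b zero))
                 (combination-* s (tail c) (tail b)))
        (≈ᴹ-sym (*ₗ-distribˡ s _ _))

      _∈Span?_ : ∀ {k} x (b : Vector Carrierᴹ k) → Dec (x ∈ Span b)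
      _∈Span?_ {k} x b = anyVector? k
        (λ c≈d p → ≈ᴹ-trans (≈ᴹ-sym (combination-congˡ b c≈d)) p)
        (λ c → combination c b ≟ᴹ x)

      skip : ∀ {k d} {w₀} {w : Vector Carrierᴹ k} (b : Vector Carrierᴹ d) →
        w₀ ∈ Span b → Span b ≐ Span w → Span b ≐ Span (w₀ ∷ w)
      skip {w₀ = w₀} {w} b (c , cb≈w₀) (b⊆w , w⊆b) = to , from
        where
        to : Span b ⊆ Span (w₀ ∷ w)
        to x∈b with e , ew≈x ← b⊆w x∈b = (0# ∷ e) ,
          ≈ᴹ-trans (+ᴹ-cong (*ₗ-zeroˡ w₀) ew≈x) (+ᴹ-identityˡ _)

        from : Span (w₀ ∷ w) ⊆ Span b
        from {x} (e , ew≈x) with d , db≈ew ← w⊆b (tail e , ≈ᴹ-refl) =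
          (λ i → e zero * c i + d i) , (begin
            combination (λ i → e zero * c i + d i) b
              ≈⟨ combination-+ (λ i → e zero * c i) d b ⟩
            combination (λ i → e zero * c i) b +ᴹ combination d b
              ≈⟨ +ᴹ-cong (≈ᴹ-trans (combination-* (e zero) c b) (*ₗ-congˡ cb≈w₀)) db≈ew ⟩
            e zero *ₗ w₀ +ᴹ combination (tail e) w
              ≈⟨ ew≈x ⟩
            x ∎)

      add : ∀ {k d} {w₀} {w : Vector Carrierᴹ k} (b : Vector Carrierᴹ d) →
        Span b ≐ Span w → Span (w₀ ∷ b) ≐ Span (w₀ ∷ w)
      add b (b⊆w , w⊆b) = lift b⊆w , lift w⊆b
        where
        lift : ∀ {k d w₀} {f : Vector Carrierᴹ k} {g : Vector Carrierᴹ d} →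
          Span f ⊆ Span g → Span (w₀ ∷ f) ⊆ Span (w₀ ∷ g)
        lift f⊆g (e , ef≈x) with d , dg≈ef ← f⊆g (tail e , ≈ᴹ-refl) =
          (head e ∷ d) , ≈ᴹ-trans (+ᴹ-congˡ dg≈ef) ef≈x

      extend : ∀ {d w₀} {b : Vector Carrierᴹ d} → w₀ ∉ Span b →
        LinearlyIndependent b → LinearlyIndependent (w₀ ∷ b)
      extend {w₀ = w₀} {b} w₀∉b indep c cb≈0 with zero-or-unit (c zero)
      ... | inj₁ c₀≈0 = λ where
        zero    → c₀≈0
        (suc i) → indep (tail c) (begin
          combination (tail c) b
            ≈⟨ +ᴹ-identityˡ _ ⟨
          0ᴹ +ᴹ combination (tail c) b
            ≈⟨ +ᴹ-congʳ (x≈0⇒x*y≈0 c₀≈0) ⟨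
          c zero *ₗ w₀ +ᴹ combination (tail c) b
            ≈⟨ cb≈0 ⟩
          0ᴹ ∎) i
      ... | inj₂ (y , yc₀≈1) = contradiction
        ((λ i → y * (- 1# * c (suc i))) , (begin
          combination (λ i → y * (- 1# * c (suc i))) b
            ≈⟨ combination-* y (λ i → - 1# * c (suc i)) b ⟩
          y *ₗ combination (λ i → - 1# * c (suc i)) b
            ≈⟨ *ₗ-congˡ (combination-* (- 1#) (tail c) b) ⟩
          y *ₗ (- 1# *ₗ z)
            ≈⟨ *ₗ-congˡ (+ᴹ-identityˡ _) ⟨
          y *ₗ (0ᴹ +ᴹ - 1# *ₗ z)
            ≈⟨ *ₗ-congˡ (+ᴹ-congʳ cb≈0) ⟨
          y *ₗ (c zero *ₗ w₀ +ᴹ z +ᴹ - 1# *ₗ z)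
            ≈⟨ *ₗ-congˡ (+ᴹ-assoc _ _ _) ⟩
          y *ₗ (c zero *ₗ w₀ +ᴹ (z +ᴹ - 1# *ₗ z))
            ≈⟨ *ₗ-congˡ (+ᴹ-congˡ z-z≈0) ⟩
          y *ₗ (c zero *ₗ w₀ +ᴹ 0ᴹ)
            ≈⟨ *ₗ-congˡ (+ᴹ-identityʳ _) ⟩
          y *ₗ (c zero *ₗ w₀)
            ≈⟨ *ₗ-assoc y (c zero) w₀ ⟨
          (y * c zero) *ₗ w₀
            ≈⟨ *ₗ-congʳ yc₀≈1 ⟩
          1# *ₗ w₀
            ≈⟨ *ₗ-identityˡ w₀ ⟩
          w₀ ∎)) w₀∉b
        where
        z = combination (tail c) b

        z-z≈0 : z +ᴹ - 1# *ₗ z ≈ᴹ 0ᴹ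
        z-z≈0 = begin
          z +ᴹ - 1# *ₗ z        ≈⟨ +ᴹ-congʳ (*ₗ-identityˡ z) ⟨
          1# *ₗ z +ᴹ - 1# *ₗ z  ≈⟨ *ₗ-distribʳ z 1# (- 1#) ⟨
          (1# + - 1#) *ₗ z      ≈⟨ x≈0⇒x*y≈0 (-‿inverseʳ 1#) ⟩
          0ᴹ                    ∎

    -- Abstract: only the statement should matter, not which basis is found.
    abstract
      span-dimension : ∀ {k} (w : Vector Carrierᴹ k) → ∃[ d ] HasDimension (Span w) d
      span-dimension {zero} w = 0 , w , (λ _ _ ()) , (λ x∈w → x∈w) , (λ x∈w → x∈w)
      span-dimension {suc k} w with span-dimension (tail w)
      ... | d , b , indep , b≐w with head w ∈Span? b
      ...   | yes w₀∈b = d , b , indep , skip b w₀∈b b≐w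
      ...   | no w₀∉b  = suc d , head w ∷ b , extend w₀∉b indep , add b b≐w

module FlagRank {c ℓ₁ ℓ₂ q} (𝔽 : FiniteField c ℓ₁ ℓ₂ q) where
  open FiniteField 𝔽
  open CommutativeRing commutativeRing using (Carrier; _≈_; 0#; _*_; +-monoid)
  open FiniteDimension 𝔽 using (_≟_; span-dimension)

  𝔽^_ : ℕ → Module commutativeRing c ℓ₁
  𝔽^ m = pointwise (Fin m) ⟨module⟩

  Mat : ℕ → ℕ → Module commutativeRing c ℓ₁
  Mat m n = pointwise (Fin m) (𝔽^ n)

  Matrix : ℕ → ℕ → Set c
  Matrix m n = Vector (Vector Carrier n) m

  ColumnSpace : ∀ {m n} → Matrix m n → Pred (Vector Carrier m) (c ⊔ ℓ₁)
  ColumnSpace {m} M = LinearAlgebra.Span (𝔽^ m) (λ j i → M i j)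

  rank-exists : ∀ {m n} (M : Matrix m n) →
    ∃[ r ] LinearAlgebra.HasDimension (𝔽^ m) (ColumnSpace M) r
  rank-exists {m} M =
    span-dimension (𝔽^ m) (λ x y → Fin.all? (λ i → x i ≟ y i)) (λ j i → M i j)

  rk : ∀ {m n} → Matrix m n → ℕ
  rk M = proj₁ (rank-exists M)

  -- Indices are 0-based: M [ i ] has the rows 0, …, i and the columns
  -- i, …, n - 1 of M, so it is the submatrix written M_[i+1] with 1-based
  -- indices.
  _[_] : ∀ {n} → Matrix n n → (i : Fin n) → Matrix (suc (toℕ i)) (n ∸ toℕ i)
  (M [ i ]) r s = M (Fin.inject≤ r (toℕ<n i))
                    (Fin.cast (m+[n∸m]≡n (toℕ≤n i)) (toℕ i ↑ʳ s))

  fr : ∀ {n} → Matrix n n → ℕ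
  fr M = MonoidSum.sum +-0-monoid (λ i → rk (M [ i ]))

  U : ∀ n → Pred (Matrix n n) ℓ₁
  U n M = ∀ i j → toℕ j < toℕ i → M i j ≈ 0#

  module _ {n : ℕ} where
    open Module (Mat n n)
    open LinearAlgebra (Mat n n)

    IsLinearCode : ∀ {p} → Pred (Matrix n n) p → Set (c ⊔ ℓ₁ ⊔ p)
    IsLinearCode 𝒞 = IsSubspace 𝒞 × 𝒞 ⊆ U n

    HasMinimumDistance : ∀ {p} → Pred (Matrix n n) p → ℕ → Set (c ⊔ ℓ₁ ⊔ p)
    HasMinimumDistance 𝒞 δ =
      (∃[ M ] M ∈ 𝒞 × ¬ M ≈ᴹ 0ᴹ × fr M ≡ δ) ×
      (∀ M → M ∈ 𝒞 → ¬ M ≈ᴹ 0ᴹ → δ ≤ fr M)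

    HasCodimension : ∀ {p} → Pred (Matrix n n) p → ℕ → Set (c ⊔ ℓ₁ ⊔ p)
    HasCodimension 𝒞 k = ∃[ d ] HasDimension 𝒞 d × n ℕ.* suc n / 2 ≡ d ℕ.+ k

    Ball : ℕ → Pred (Matrix n n) ℓ₁
    Ball t A = A ∈ U n × fr A ≤ t

    IsPerfect : ∀ {p} → Pred (Matrix n n) p → Set (c ⊔ ℓ₁ ⊔ p)
    IsPerfect 𝒞 = ∃[ δ ] HasMinimumDistance 𝒞 δ ×
      (∃[ s ] ∃[ b ] HasSize 𝒞 s × HasSize (Ball ((δ ∸ 1) / 2)) b ×
        s ℕ.* b ≡ q ^ (n ℕ.* suc n / 2))

    IsNonTrivial : ∀ {p} → Pred (Matrix n n) p → Set (c ⊔ ℓ₁ ⊔ p)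
    IsNonTrivial 𝒞 = ¬ (𝒞 ≐ U n)

  open LinearAlgebra (𝔽^ 3) using (Span)

  record Point : Set (c ⊔ ℓ₁) where
    field
      rep     : Vector Carrier 3
      nonzero : ¬ Module._≈ᴹ_ (𝔽^ 3) rep (Module.0ᴹ (𝔽^ 3))

    ⟨_⟩ : Pred (Vector Carrier 3) (c ⊔ ℓ₁)
    ⟨_⟩ = Span (rep ∷ [])

  open Point

  SamePoint : Point → Point → Set (c ⊔ ℓ₁)
  SamePoint P Q = ⟨ P ⟩ ≐ ⟨ Q ⟩

  OnLine : Point → Point → Point → Set (c ⊔ ℓ₁)
  OnLine X P Q = ⟨ X ⟩ ⊆ Span (rep P ∷ rep Q ∷ [])

  -- The construction is stated for n = suc m, so that 2n - 1 = suc (m * 2).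
  interleave : ∀ {a} {A : Set a} {m} → Vector A (suc m) → Vector A m →
    Vector A (suc (m ℕ.* 2))
  interleave {m = zero}  x y = x
  interleave {m = suc m} x y = head x ∷ head y ∷ interleave (tail x) (tail y)

  -- P i and Q i stand for P_{i+1} = [u_{i+1}] and Q_{i+1} = [v_{i+1}]; the
  -- chosen representatives u and v are part of the data of a Point.
  record Configuration (m : ℕ) : Set (c ⊔ ℓ₁) where
    field
      3≤n      : 3 ≤ suc m
      n≤q²+q+1 : suc m ≤ q ^ 2 ℕ.+ q ℕ.+ 1
      P        : Vector Point (suc m)
      Q        : Vector Point m
      distinct : ∀ i j → i ≢ j → ¬ SamePoint (P i) (P j)
      off-line : ∀ i → ¬ OnLine (Q i) (P (inject₁ i)) (P (suc i))

  D₂ : ∀ n → Pred (Matrix n n) ℓ₁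
  D₂ n A = A ∈ U n × (∀ i j → 2 ℕ.+ toℕ i ≤ toℕ j → A i j ≈ 0#)

  -- The space written Ū(n-2): its elements are n × n matrices.
  Ū : ∀ n → Pred (Matrix n n) ℓ₁
  Ū n A = A ∈ U n × (∀ i j → ¬ (2 ℕ.+ toℕ i ≤ toℕ j) → A i j ≈ 0#)

  -- ρ reads off the coordinates (λ₁, μ₁, λ₂, …, μₙ₋₁, λₙ); it is the
  -- isomorphism of the construction when restricted to D₂.
  ρ : ∀ {m} → Matrix (suc m) (suc m) → Vector Carrier (suc (m ℕ.* 2))
  ρ A = interleave (λ i → A i i) (λ i → A (inject₁ i) (suc i))

  ker : ∀ {m n} → Matrix m n → Pred (Vector Carrier n) ℓ₁
  ker H x = ∀ i → MonoidSum.sum +-monoid (λ j → H i j * x j) ≈ 0#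

  module _ {m : ℕ} (C : Configuration m) where
    open Configuration C
    open LinearAlgebra (Mat (suc m) (suc m)) using (_⊕_)

    H : Matrix 3 (suc (m ℕ.* 2))
    H r j = interleave (rep ∘ P) (rep ∘ Q) j r

    ρ⁻¹D : Pred (Matrix (suc m) (suc m)) ℓ₁
    ρ⁻¹D A = A ∈ D₂ (suc m) × ρ A ∈ ker H

    -- D₂ and Ū have disjoint supports, so this sum is direct.
    𝒟 : Pred (Matrix (suc m) (suc m)) (c ⊔ ℓ₁)
    𝒟 = ρ⁻¹D ⊕ Ū (suc m)

{-# OPTIONS --safe #-}

-- Write syn A = H · ρ(A) for the syndrome.  Since Ū(n-2) lies in the kernel of
-- A ↦ ρ(A), the code 𝒟 consists of the upper triangular A with syn A = 0.
-- A nonzero entry at (i, j) makes M_[k] nonzero for i ≤ k ≤ j, so a matrix of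
-- flag-rank at most 2 is either diagonal with at most two nonzero entries, or
-- supported on positions (i, i), (i, i+1), (i+1, i+1); its syndrome is then a
-- relation between P_i and P_j, respectively between P_i, Q_i and P_{i+1}, and
-- such a relation is trivial by the choice of the points.  A matrix unit two
-- steps above the diagonal has flag-rank 3.  Finally u_1, v_1, u_2 is a basis of
-- 𝔽³, so the entries of a codeword outside the three positions (1, 1), (1, 2),
-- (2, 2) are free, and the ball of radius 1 consists of the matrices with at
-- most one nonzero entry, on the diagonal, hence has 1 + n(q - 1) = q³ elements.

module Submission where

open import Defs
open import Algebra.Bundles using (CommutativeMonoid; CommutativeRing)
open import Algebra.Module.Bundles using (Module)
import Algebra.Properties.CommutativeMonoid.Sum as CommutativeMonoidSum
import Algebra.Properties.CommutativeSemigroup as CommutativeSemigroupProperties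
import Algebra.Properties.Ring as RingProperties
import Algebra.Properties.Semiring.Sum as SemiringSum
import Algebra.Solver.Ring.NaturalCoefficients.Default as SemiringSolver
open import Data.Bool.Base using (if_then_else_; _∧_)
open import Data.Empty using (⊥; ⊥-elim)
open import Data.Fin.Base
  using (Fin; zero; suc; toℕ; fromℕ; fromℕ<; inject₁; inject≤; cast; splitAt; _↑ˡ_; _↑ʳ_;
         punchIn; punchOut; combine; remQuot; funToFin; finToFun)
import Data.Fin.Properties as Fin
open import Data.Fin.Relation.Unary.Top using (view; ‵fromℕ; ‵inject₁)
open import Data.Nat.Base as ℕ using (ℕ; zero; suc; _≤_; _<_; z≤n; s≤s; _∸_; _^_)
open import Data.Nat.DivMod using (_/_; m*n/n≡m)
open import Data.Nat.Primality using (prime⇒nonTrivial)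
import Data.Nat.Properties as ℕ
import Data.Nat.Solver as ℕ-Solver
open import Data.Product.Base using (∃-syntax; ∃₂; _×_; _,_; proj₁; proj₂)
open import Data.Sum.Base using (inj₁; inj₂)
open import Data.Vec.Functional using (Vector; []; _∷_; removeAt)
open import Function.Base using (_∘_)
open import Function.Bundles using (Inverse)
open import Function.Definitions using (Injective)
open import Relation.Binary.Bundles using (Setoid)
import Relation.Binary.Construct.On as On
open import Relation.Binary.Definitions using (Tri; tri<; tri≈; tri>)
open import Relation.Binary.PropositionalEquality as ≡ using (_≡_; _≢_)
import Relation.Binary.Reasoning.Setoid as ≈-Reasoning
open import Relation.Nullary.Decidable using (yes; no; ⌊_⌋; ¬?; _×-dec_; decidable-stable)
open import Relation.Nullary.Negation using (¬_; contradiction)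
open import Relation.Unary using (Pred; _∈_; _⊆_)

-- Finite sets: injections, sums with small support, counting

-- Pigeonhole: deleting a missed value `y` from the codomain with `punchOut` would inject
-- `Fin (suc n)` into `Fin n`.
injective⇒surjective : ∀ {n} {f : Fin n → Fin n} → Injective _≡_ _≡_ f →
  ∀ y → ∃[ x ] f x ≡ y
injective⇒surjective {suc n} {f} f-inj y with Fin.any? (λ x → f x Fin.≟ y)
... | yes x∈f⁻¹y = x∈f⁻¹y
... | no  y∉f    = contradiction
  (Fin.injective⇒≤ λ {i} {j} eq → f-inj (Fin.punchOut-injective (y≢f i) (y≢f j) eq))
  ℕ.1+n≰n
  where
  y≢f : ∀ x → y ≢ f x
  y≢f x y≡fx = y∉f (x , ≡.sym y≡fx)

[]-injective : ∀ {a} {A : Set a} → Injective _≡_ _≡_ ([] {A = A})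
[]-injective {x = ()}

∷-injective : ∀ {a} {A : Set a} {k} {x : A} {g : Vector A k} →
  (∀ i → x ≢ g i) → Injective _≡_ _≡_ g → Injective _≡_ _≡_ (x ∷ g)
∷-injective x∉g g-inj {zero}  {zero}  _  = ≡.refl
∷-injective x∉g g-inj {zero}  {suc j} eq = contradiction eq (x∉g j)
∷-injective x∉g g-inj {suc i} {zero}  eq = contradiction (≡.sym eq) (x∉g i)
∷-injective x∉g g-inj {suc i} {suc j} eq = ≡.cong suc (g-inj eq)

[_]-injective : ∀ {a} {A : Set a} (x : A) → Injective _≡_ _≡_ (x ∷ [])
[ x ]-injective = ∷-injective (λ ()) []-injective

pair-injective : ∀ {a} {A : Set a} {x y : A} → x ≢ y →
  Injective _≡_ _≡_ (x ∷ y ∷ [])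
pair-injective x≢y = ∷-injective (λ { zero → x≢y }) [ _ ]-injective

triple-injective : ∀ {a} {A : Set a} {x y z : A} → x ≢ y → x ≢ z → y ≢ z →
  Injective _≡_ _≡_ (x ∷ y ∷ z ∷ [])
triple-injective x≢y x≢z y≢z =
  ∷-injective (λ { zero → x≢y ; (suc zero) → x≢z }) (pair-injective y≢z)

module _ {k n} {g : Fin (suc k) → Fin (suc n)} (g-inj : Injective _≡_ _≡_ g) where

  private
    g₀≢g : ∀ i → g zero ≢ g (suc i)
    g₀≢g i eq with () ← g-inj eq

  -- The values of `g` after the first, renumbered as if `g zero` had been deleted from the
  -- codomain. This drives the inductions on sums along an injection.
  removed : Fin k → Fin n
  removed i = punchOut (g₀≢g i)

  removed-injective : Injective _≡_ _≡_ removed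
  removed-injective eq =
    Fin.suc-injective (g-inj (Fin.punchOut-injective (g₀≢g _) (g₀≢g _) eq))

  punchIn-removed : ∀ i → punchIn (g zero) (removed i) ≡ g (suc i)
  punchIn-removed i = Fin.punchIn-punchOut (g₀≢g i)

module _ {c ℓ} (M : CommutativeMonoid c ℓ) where
  open CommutativeMonoid M
  open CommutativeMonoidSum M

  sum-zero : ∀ {n} (f : Vector Carrier n) → (∀ i → f i ≈ ε) → sum f ≈ ε
  sum-zero {n} f f≈0 = trans (sum-cong-≋ f≈0) (sum-replicate-zero n)

  -- Induction on `k`: the summand at `g zero` is split off, and `removed` lists the support of what
  -- remains.
  sum-support : ∀ {k n} {g : Fin k → Fin n} → Injective _≡_ _≡_ g →
    (f : Vector Carrier n) → (∀ i → (∀ j → g j ≢ i) → f i ≈ ε) →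
    sum f ≈ sum (f ∘ g)
  sum-support {zero}  g-inj f f≈0 = sum-zero f (λ i → f≈0 i (λ ()))
  sum-support {suc k} {zero} {g} g-inj f f≈0 with () ← g zero
  sum-support {suc k} {suc n} {g} g-inj f f≈0 = trans (sum-remove f)
    (∙-congˡ (trans
      (sum-support (removed-injective g-inj) (removeAt f (g zero)) λ i g≢i →
        f≈0 (punchIn (g zero) i) λ where
          zero    eq → Fin.punchInᵢ≢i (g zero) i (≡.sym eq)
          (suc j) eq → g≢i j (Fin.punchIn-injective (g zero) _ _
            (≡.trans (punchIn-removed g-inj j) eq)))
      (sum-cong-≋ (λ j → reflexive (≡.cong f (punchIn-removed g-inj j))))))

module ℕ-Sum = CommutativeMonoidSum ℕ.+-0-commutativeMonoid

sum-ones : ∀ n → ℕ-Sum.sum {n} (λ _ → 1) ≡ n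
sum-ones zero    = ≡.refl
sum-ones (suc n) = ≡.cong suc (sum-ones n)

sum-injection-≤ : ∀ {k n} {g : Fin k → Fin n} → Injective _≡_ _≡_ g →
  (f : Vector ℕ n) → ℕ-Sum.sum (f ∘ g) ≤ ℕ-Sum.sum f
sum-injection-≤ {zero}  g-inj f = z≤n
sum-injection-≤ {suc k} {zero} {g} g-inj f with () ← g zero
sum-injection-≤ {suc k} {suc n} {g} g-inj f = begin
  f (g zero) ℕ.+ ℕ-Sum.sum (f ∘ g ∘ suc)
    ≡⟨ ≡.cong (f (g zero) ℕ.+_)
         (ℕ-Sum.sum-cong-≗ (λ j → ≡.cong f (≡.sym (punchIn-removed g-inj j)))) ⟩
  f (g zero) ℕ.+ ℕ-Sum.sum (removeAt f (g zero) ∘ removed g-inj)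
    ≤⟨ ℕ.+-monoʳ-≤ (f (g zero))
         (sum-injection-≤ (removed-injective g-inj) (removeAt f (g zero))) ⟩
  f (g zero) ℕ.+ ℕ-Sum.sum (removeAt f (g zero))
    ≡⟨ ℕ-Sum.sum-remove f ⟨
  ℕ-Sum.sum f ∎
  where open ℕ.≤-Reasoning

sum-mono-≤ : ∀ {n} {f g : Vector ℕ n} → (∀ i → f i ≤ g i) →
  ℕ-Sum.sum f ≤ ℕ-Sum.sum g
sum-mono-≤ {zero}  f≤g = z≤n
sum-mono-≤ {suc n} f≤g = ℕ.+-mono-≤ (f≤g zero) (sum-mono-≤ (f≤g ∘ suc))

module _ {a ℓ} (S : Setoid a ℓ) where
  open Setoid S

  enumeration⇒cardinality : ∀ {k} (e : Fin k → Carrier) →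
    (∀ {i j} → e i ≈ e j → i ≡ j) → (∀ x → ∃[ i ] e i ≈ x) → HasCardinality S k
  enumeration⇒cardinality e e-inj e-surj = record
    { to        = index
    ; from      = e
    ; to-cong   = λ x≈y → e-inj (trans (e-index _) (trans x≈y (sym (e-index _))))
    ; from-cong = reflexive ∘ ≡.cong e
    ; inverse   = (λ y≈ei → e-inj (trans (e-index _) y≈ei))
                , (λ { ≡.refl → e-index _ })
    }
    where
    index : Carrier → Fin _
    index x = proj₁ (e-surj x)

    e-index : ∀ x → e (index x) ≈ x
    e-index x = proj₂ (e-surj x)

-- Linear algebra in modules over a commutative ring

module _ {r ℓr v ℓv} {R : CommutativeRing r ℓr} (V : Module R v ℓv) where
  open CommutativeRing R hiding (zero)
  open RingProperties ring using (x∙y⁻¹≈ε⇒x≈y; -1*x≈-x)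
  open Module V
  open LinearAlgebra V
  open CommutativeMonoidSum +ᴹ-commutativeMonoid using (sum; sum-cong-≋; ∑-distrib-+)
  open ≈-Reasoning ≈ᴹ-setoid

  combination-cong : ∀ {k} {c d : Vector Carrier k} {b b′ : Vector Carrierᴹ k} →
    (∀ i → c i ≈ d i) → (∀ i → b i ≈ᴹ b′ i) → combination c b ≈ᴹ combination d b′
  combination-cong c≈d b≈b′ = sum-cong-≋ (λ i → *ₗ-cong (c≈d i) (b≈b′ i))

  combination-+ : ∀ {k} (c d : Vector Carrier k) b →
    combination (λ i → c i + d i) b ≈ᴹ combination c b +ᴹ combination d b
  combination-+ c d b = ≈ᴹ-trans
    (sum-cong-≋ (λ i → *ₗ-distribʳ (b i) (c i) (d i)))
    (∑-distrib-+ (λ i → c i *ₗ b i) (λ i → d i *ₗ b i))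

  combination-* : ∀ {k} s (c : Vector Carrier k) b →
    combination (λ i → s * c i) b ≈ᴹ s *ₗ combination c b
  combination-* {zero}  s c b = ≈ᴹ-sym (*ₗ-zeroʳ s)
  combination-* {suc k} s c b = ≈ᴹ-trans
    (+ᴹ-cong (*ₗ-assoc s (c zero) (b zero)) (combination-* s (c ∘ suc) (b ∘ suc)))
    (≈ᴹ-sym (*ₗ-distribˡ s _ _))

  x+-1*x≈0 : ∀ x → x +ᴹ - 1# *ₗ x ≈ᴹ 0ᴹ
  x+-1*x≈0 x = begin
    x +ᴹ - 1# *ₗ x        ≈⟨ +ᴹ-congʳ (*ₗ-identityˡ x) ⟨
    1# *ₗ x +ᴹ - 1# *ₗ x  ≈⟨ *ₗ-distribʳ x 1# (- 1#) ⟨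
    (1# + - 1#) *ₗ x      ≈⟨ *ₗ-congʳ (-‿inverseʳ 1#) ⟩
    0# *ₗ x               ≈⟨ *ₗ-zeroˡ x ⟩
    0ᴹ                    ∎

  x+-1*y≈0⇒x≈y : ∀ {x y} → x +ᴹ - 1# *ₗ y ≈ᴹ 0ᴹ → x ≈ᴹ y
  x+-1*y≈0⇒x≈y {x} {y} eq = begin
    x                       ≈⟨ +ᴹ-identityʳ x ⟨
    x +ᴹ 0ᴹ                 ≈⟨ +ᴹ-congˡ (x+-1*x≈0 y) ⟨
    x +ᴹ (y +ᴹ - 1# *ₗ y)   ≈⟨ +ᴹ-congˡ (+ᴹ-comm _ _) ⟩
    x +ᴹ (- 1# *ₗ y +ᴹ y)   ≈⟨ +ᴹ-assoc _ _ _ ⟨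
    x +ᴹ - 1# *ₗ y +ᴹ y     ≈⟨ +ᴹ-congʳ eq ⟩
    0ᴹ +ᴹ y                 ≈⟨ +ᴹ-identityˡ y ⟩
    y                       ∎

  -- Independence is applied to the difference of the coefficients. It is written with `- 1# *` so
  -- that `combination-+` and `combination-*` evaluate it.
  combination-injective : ∀ {k} {b : Vector Carrierᴹ k} → LinearlyIndependent b →
    ∀ {c d} → combination c b ≈ᴹ combination d b → ∀ i → c i ≈ d i
  combination-injective {b = b} indep {c} {d} eq i =
    x∙y⁻¹≈ε⇒x≈y (c i) (d i) (trans (+-congˡ (sym (-1*x≈-x (d i)))) (indep _ (begin
      combination (λ i → c i + - 1# * d i) b
        ≈⟨ combination-+ c (λ i → - 1# * d i) b ⟩
      combination c b +ᴹ combination (λ i → - 1# * d i) b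
        ≈⟨ +ᴹ-cong eq (combination-* (- 1#) d b) ⟩
      combination d b +ᴹ - 1# *ₗ combination d b
        ≈⟨ x+-1*x≈0 _ ⟩
      0ᴹ ∎) i))

  combination-closed : ∀ {p} {S : Pred Carrierᴹ p} → IsSubspace S →
    ∀ {k} (c : Vector Carrier k) {b} → (∀ i → b i ∈ S) → combination c b ∈ S
  combination-closed S≤V {zero}  c b∈S = IsSubspace.0-closed S≤V
  combination-closed S≤V {suc k} c b∈S = IsSubspace.+-closed S≤V
    (IsSubspace.*-closed S≤V (c zero) (b∈S zero))
    (combination-closed S≤V (c ∘ suc) (b∈S ∘ suc))

  Span-isSubspace : ∀ {k} (b : Vector Carrierᴹ k) → IsSubspace (Span b)
  Span-isSubspace b = record
    { resp     = λ x≈y (c , cb≈x) → c , ≈ᴹ-trans cb≈x x≈y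
    ; 0-closed = (λ _ → 0#) ,
        sum-zero +ᴹ-commutativeMonoid (λ i → 0# *ₗ b i) (λ i → *ₗ-zeroˡ (b i))
    ; +-closed = λ (c , cb≈x) (d , db≈y) → (λ i → c i + d i) ,
        ≈ᴹ-trans (combination-+ c d b) (+ᴹ-cong cb≈x db≈y)
    ; *-closed = λ s (c , cb≈x) → (λ i → s * c i) ,
        ≈ᴹ-trans (combination-* s c b) (*ₗ-congˡ cb≈x)
    }

  generator∈Span : ∀ {k} (b : Vector Carrierᴹ k) i → b i ∈ Span b
  generator∈Span b zero = (1# ∷ λ _ → 0#) , ≈ᴹ-trans
    (+ᴹ-cong (*ₗ-identityˡ (b zero)) (proj₂ (IsSubspace.0-closed (Span-isSubspace (b ∘ suc)))))
    (+ᴹ-identityʳ _)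
  generator∈Span b (suc i) with c , cb≈bᵢ ← generator∈Span (b ∘ suc) i =
    (0# ∷ c) , ≈ᴹ-trans (+ᴹ-cong (*ₗ-zeroˡ (b zero)) cb≈bᵢ) (+ᴹ-identityˡ _)

-- Linear algebra over a finite field by counting vectors

module FiniteFieldLinearAlgebra {c ℓ₁ ℓ₂ q} (𝔽 : FiniteField c ℓ₁ ℓ₂ q) where
  open FiniteField 𝔽
  open CommutativeRing commutativeRing hiding (zero)
  open FlagRank 𝔽 using (𝔽^_)
  open FiniteDimension 𝔽 using (_≟_; zero-or-unit)
  module Enum = Inverse cardinality

  x≉0⇒unit : ∀ {x} → ¬ x ≈ 0# → ∃[ y ] y * x ≈ 1#
  x≉0⇒unit {x} x≉0 with zero-or-unit x
  ... | inj₁ x≈0  = contradiction x≈0 x≉0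
  ... | inj₂ unit = unit

  from-injective : ∀ {i j} → Enum.from i ≈ Enum.from j → i ≡ j
  from-injective eq = ≡.trans (≡.sym (Enum.strictlyInverseˡ _))
    (≡.trans (Enum.to-cong eq) (Enum.strictlyInverseˡ _))

  module _ {k : ℕ} where
    -- Numbering the vectors by `Fin (q ^ k)` turns statements about dimension into statements about
    -- maps between finite sets.
    encode : Vector Carrier k → Fin (q ^ k)
    encode x = funToFin (Enum.to ∘ x)

    decode : Fin (q ^ k) → Vector Carrier k
    decode a i = Enum.from (finToFun {q} {k} a i)

    decode-encode : ∀ x i → decode (encode x) i ≈ x i
    decode-encode x i = trans
      (Enum.from-cong (Fin.finToFun-funToFin (Enum.to ∘ x) i))
      (Enum.strictlyInverseʳ (x i))

    encode-injective : ∀ {x y} → encode x ≡ encode y → ∀ i → x i ≈ y i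
    encode-injective {x} {y} eq i = trans (sym (decode-encode x i))
      (trans (reflexive (≡.cong (λ a → decode a i) eq)) (decode-encode y i))

    decode-injective : ∀ {a b} → (∀ i → decode a i ≈ decode b i) → a ≡ b
    decode-injective {a} {b} eq = ≡.trans (≡.sym (Fin.funToFin-finToFin {k} {q} a))
      (≡.trans (funToFin-cong {k} (λ i → from-injective (eq i))) (Fin.funToFin-finToFin {k} {q} b))
      where
      funToFin-cong : ∀ {m} {f g : Fin m → Fin q} → (∀ i → f i ≡ g i) → funToFin f ≡ funToFin g
      funToFin-cong {zero}  f≗g = ≡.refl
      funToFin-cong {suc m} f≗g =
        ≡.cong₂ combine (f≗g zero) (funToFin-cong (f≗g ∘ suc))

  module _ {v ℓv} (V : Module commutativeRing v ℓv) where
    open Module V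
    open LinearAlgebra V

    dimension⇒size : ∀ {p} {S : Pred Carrierᴹ p} {d} → HasDimension S d → HasSize S (q ^ d)
    dimension⇒size {S = S} {d} (b , indep , b⊆S , S⊆b) =
      enumeration⇒cardinality (On.setoid ≈ᴹ-setoid (proj₁ {B = S}))
        (λ a → combination (decode {d} a) b , b⊆S (decode {d} a , ≈ᴹ-refl))
        (λ eq → decode-injective {d} (combination-injective V indep eq))
        (λ (x , x∈S) → let (e , eb≈x) = S⊆b x∈S in encode e ,
          ≈ᴹ-trans (combination-cong V (decode-encode e) (λ _ → ≈ᴹ-refl)) eb≈x)

    -- Coefficients over w inject 𝔽ᵏ into 𝔽ᵗ, so q ^ k ≤ q ^ t.
    independent-bound : 1 ℕ.< q → ∀ {k t} {b : Vector Carrierᴹ k} (w : Vector Carrierᴹ t) →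
      LinearlyIndependent b → (∀ i → b i ∈ Span w) → k ≤ t
    independent-bound 1<q {k} {t} {b} w indep b∈w = ℕ.≮⇒≥ λ t<k →
      ℕ.<⇒≱ (ℕ.^-monoʳ-< q 1<q t<k) (Fin.injective⇒≤ coefficients-injective)
      where
      coefficients : ∀ (a : Fin (q ^ k)) → combination (decode {k} a) b ∈ Span w
      coefficients a = combination-closed V (Span-isSubspace V w) (decode {k} a) b∈w

      coefficients-injective : Injective _≡_ _≡_ (encode ∘ proj₁ ∘ coefficients)
      coefficients-injective {x} {y} eq = decode-injective {k}
        (combination-injective V indep (≈ᴹ-trans (≈ᴹ-sym (proj₂ (coefficients x)))
          (≈ᴹ-trans (combination-cong V {b = w} (encode-injective {t} eq) (λ _ → ≈ᴹ-refl))
            (proj₂ (coefficients y)))))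

  -- For `k` independent vectors in dimension `k`, passing from coefficients to combinations is an
  -- injective self-map of `Fin (q ^ k)`, hence surjective.
  independent⇒spanning : ∀ {k} {b : Vector (Vector Carrier k) k} →
    LinearAlgebra.LinearlyIndependent (𝔽^ k) b → ∀ x → x ∈ LinearAlgebra.Span (𝔽^ k) b
  independent⇒spanning {k} {b} indep x =
    let (a , eq) = injective⇒surjective combine-injective (encode x)
    in decode {k} a , encode-injective eq
    where
    open LinearAlgebra (𝔽^ k)

    combine-injective : Injective _≡_ _≡_ (λ (a : Fin (q ^ k)) → encode (combination (decode {k} a) b))
    combine-injective eq =
      decode-injective {k} (combination-injective (𝔽^ k) indep (encode-injective eq))

-- Bounds on rank and flag-rank

module FlagRankBounds {c ℓ₁ ℓ₂ q} (𝔽 : FiniteField c ℓ₁ ℓ₂ q) (1<q : 1 < q) where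
  open FiniteField 𝔽
  open CommutativeRing commutativeRing hiding (zero; _-_)
  open FlagRank 𝔽
  open FiniteFieldLinearAlgebra 𝔽

  -- If 1 = 0, all elements coincide, and `from` would identify the distinct indices 0 and 1 of
  -- `Fin q`.
  1≉0 : ¬ 1# ≈ 0#
  1≉0 1≈0 = contradiction
    (≡.trans (≡.sym (Fin.toℕ-fromℕ< 0<q))
      (≡.trans (≡.cong toℕ (from-injective (trans (x≈0 _) (sym (x≈0 _)))))
        (Fin.toℕ-fromℕ< 1<q)))
    λ ()
    where
    0<q = ℕ.<-trans ℕ.z<s 1<q

    x≈0 : ∀ x → x ≈ 0#
    x≈0 x = trans (sym (*-identityˡ x)) (trans (*-congʳ 1≈0) (zeroˡ x))

  module _ {m n : ℕ} (M : Matrix m n) where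
    open LinearAlgebra (𝔽^ m)

    -- `rk` is opaque and known only through an accompanying basis of the column space. That basis
    -- lies in the span of `w`, so `independent-bound` compares the lengths.
    rk-bound : ∀ {t} (w : Vector (Vector Carrier m) t) →
      (∀ s → (λ r → M r s) ∈ Span w) → rk M ≤ t
    rk-bound w M∈w with rank-exists M
    ... | r , b , indep , b⊆M , M⊆b = independent-bound (𝔽^ m) 1<q w indep λ i →
      let (e , eM≈b) = b⊆M (generator∈Span (𝔽^ m) b i)
      in IsSubspace.resp (Span-isSubspace (𝔽^ m) w) eM≈b
           (combination-closed (𝔽^ m) (Span-isSubspace (𝔽^ m) w) e M∈w)

    -- The basis is empty, so each column is an empty combination.
    rk≡0⇒zero : rk M ≡ 0 → ∀ r s → M r s ≈ 0#
    rk≡0⇒zero rk≡0 r s with rank-exists M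
    rk≡0⇒zero ≡.refl r s | 0 , b , indep , b⊆M , M⊆b
      with e , 0≈M ← M⊆b (generator∈Span (𝔽^ m) (λ j i → M i j) s) = sym (0≈M r)

  module _ {n : ℕ} where

    flag-row : ∀ (k : Fin n) → Fin (suc (toℕ k)) → Fin n
    flag-row k r = inject≤ r (Fin.toℕ<n k)

    flag-column : ∀ (k : Fin n) → Fin (n ∸ toℕ k) → Fin n
    flag-column k s = cast (ℕ.m+[n∸m]≡n (Fin.toℕ≤n k)) (toℕ k ↑ʳ s)

    flag-row-≤ : ∀ k r → toℕ (flag-row k r) ≤ toℕ k
    flag-row-≤ k r = ℕ.≤-trans (ℕ.≤-reflexive (Fin.toℕ-inject≤ r _)) (ℕ.s≤s⁻¹ (Fin.toℕ<n r))

    flag-column-≥ : ∀ k s → toℕ k ≤ toℕ (flag-column k s)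
    flag-column-≥ k s = ℕ.≤-trans (ℕ.m≤m+n (toℕ k) (toℕ s))
      (ℕ.≤-reflexive (≡.sym (≡.trans (Fin.toℕ-cast _ _) (Fin.toℕ-↑ʳ (toℕ k) s))))

  module _ {n : ℕ} (M : Matrix n n) where

    entry-in-flag : ∀ {i j k} → toℕ i ≤ toℕ k → toℕ k ≤ toℕ j →
      ∃₂ λ r s → (M [ k ]) r s ≡ M i j
    entry-in-flag {i} {j} {k} i≤k k≤j = r , s , ≡.cong₂ M
      (Fin.toℕ-injective (≡.trans (Fin.toℕ-inject≤ r _) (Fin.toℕ-fromℕ< _)))
      (Fin.toℕ-injective (≡.trans (Fin.toℕ-cast _ _) (≡.trans (Fin.toℕ-↑ʳ (toℕ k) s)
        (≡.trans (≡.cong (toℕ k ℕ.+_) (Fin.toℕ-fromℕ< _)) (ℕ.m+[n∸m]≡n k≤j)))))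
      where
      r = fromℕ< (s≤s i≤k)
      -- The columns of `M [ k ]` start at column `k` of `M`, so column `j` has index `j ∸ k` there.
      s = fromℕ< (ℕ.∸-monoˡ-< (Fin.toℕ<n j) k≤j)

    -- Each of the `t` distinct blocks `M [ g a ]` contains a nonzero entry and so has rank at least
    -- 1. The same entry may serve several blocks.
    flag-rank-lower-bound : ∀ {t} {g : Fin t → Fin n} → Injective _≡_ _≡_ g →
      (∀ a → ∃₂ λ i j → ¬ M i j ≈ 0# × toℕ i ≤ toℕ (g a) × toℕ (g a) ≤ toℕ j) → t ≤ fr M
    flag-rank-lower-bound {t} {g} g-inj nonzero = begin
      t                                         ≡⟨ sum-ones t ⟨
      ℕ-Sum.sum {t} (λ _ → 1)                   ≤⟨ sum-mono-≤ 1≤rk ⟩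
      ℕ-Sum.sum (λ a → rk (M [ g a ]))          ≤⟨ sum-injection-≤ g-inj _ ⟩
      fr M                                      ∎
      where
      open ℕ.≤-Reasoning

      1≤rk : ∀ a → 1 ≤ rk (M [ g a ])
      1≤rk a with nonzero a
      ... | i , j , Mij≉0 , i≤ga , ga≤j with r , s , eq ← entry-in-flag i≤ga ga≤j =
        ℕ.n≢0⇒n>0 λ rk≡0 →
          Mij≉0 (trans (reflexive (≡.sym eq)) (rk≡0⇒zero (M [ g a ]) rk≡0 r s))

  module _ {n : ℕ} where

    E : Fin n → Fin n → Carrier → Matrix n n
    E i j x r s = if ⌊ i Fin.≟ r ⌋ ∧ ⌊ j Fin.≟ s ⌋ then x else 0#

    E-at : ∀ i j x → E i j x i j ≡ x
    E-at i j x rewrite ≡.≡-≟-identity Fin._≟_ (≡.refl {x = i})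
                     | ≡.≡-≟-identity Fin._≟_ (≡.refl {x = j}) = ≡.refl

    E-off : ∀ i j x r s → ¬ (i ≡ r × j ≡ s) → E i j x r s ≡ 0#
    E-off i j x r s ≢ with i Fin.≟ r | j Fin.≟ s
    ... | yes i≡r | yes j≡s = contradiction (i≡r , j≡s) ≢
    ... | yes _   | no _    = ≡.refl
    ... | no _    | _       = ≡.refl

    -- The matrix as an outer product: every column is a multiple, by 0 or 1, of one fixed column.
    -- Both factors are read off as diagonal entries of matrix units. This bounds the rank of each
    -- block by 1.
    E-column : ∀ i j x r s → E i j x r s ≈ E j j 1# s s * E i i x r r
    E-column i j x r s with i Fin.≟ r | j Fin.≟ s
    ... | yes _ | yes _ = sym (*-identityˡ x)
    ... | yes _ | no _  = sym (zeroˡ x)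
    ... | no _  | yes _ = sym (zeroʳ 1#)
    ... | no _  | no _  = sym (zeroˡ 0#)

    rk-E≤1 : ∀ i j x k → rk (E i j x [ k ]) ≤ 1
    rk-E≤1 i j x k = rk-bound (E i j x [ k ]) ((λ r → E i i x (flag-row k r) (flag-row k r)) ∷ [])
      λ s → let s′ = flag-column k s in
        (λ _ → E j j 1# s′ s′) , λ r → trans (+-identityʳ _) (sym (E-column i j x (flag-row k r) s′))

    rk-E≡0 : ∀ i j x k → ¬ (toℕ i ≤ toℕ k × toℕ k ≤ toℕ j) → rk (E i j x [ k ]) ≡ 0
    rk-E≡0 i j x k k∉[i,j] = ℕ.n≤0⇒n≡0 (rk-bound (E i j x [ k ]) [] λ s →
      (λ ()) , λ r → reflexive (≡.sym (E-off i j x (flag-row k r) (flag-column k s) λ where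
        (i≡r , j≡s) → k∉[i,j]
          ( ≡.subst (λ z → toℕ z ≤ toℕ k) (≡.sym i≡r) (flag-row-≤ k r)
          , ≡.subst (λ z → toℕ k ≤ toℕ z) (≡.sym j≡s) (flag-column-≥ k s)))))

    -- A block `M [ k ]` sees the entry only for `k` between `i` and `j`. All these `k` are listed
    -- by `g`, and each contributes at most 1.
    fr-E-bound : ∀ {t} {g : Fin t → Fin n} → Injective _≡_ _≡_ g → ∀ i j x →
      (∀ k → (∀ a → g a ≢ k) → ¬ (toℕ i ≤ toℕ k × toℕ k ≤ toℕ j)) → fr (E i j x) ≤ t
    fr-E-bound {t} {g} g-inj i j x outside = begin
      fr (E i j x)
        ≡⟨ sum-support ℕ.+-0-commutativeMonoid g-inj _
             (λ k g≢k → rk-E≡0 i j x k (outside k g≢k)) ⟩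
      ℕ-Sum.sum (λ a → rk (E i j x [ g a ]))
        ≤⟨ sum-mono-≤ (λ a → rk-E≤1 i j x (g a)) ⟩
      ℕ-Sum.sum {t} (λ _ → 1)
        ≡⟨ sum-ones t ⟩
      t ∎
      where
      open ℕ.≤-Reasoning

-- Syndromes and the parity-check description of the code

module DotProduct {c ℓ} (R : CommutativeRing c ℓ) where
  open CommutativeRing R hiding (zero)
  open CommutativeMonoidSum +-commutativeMonoid
  open SemiringSum semiring using (*-distribˡ-sum)
  open CommutativeSemigroupProperties *-commutativeSemigroup using (x∙yz≈y∙xz)

  dot : ∀ {n} → Vector Carrier n → Vector Carrier n → Carrier
  dot w a = sum (λ i → w i * a i)

  dot-cong : ∀ {n} (w : Vector Carrier n) {a b : Vector Carrier n} →
    (∀ i → a i ≈ b i) → dot w a ≈ dot w b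
  dot-cong w a≈b = sum-cong-≋ (λ i → *-congˡ (a≈b i))

  dot-zero : ∀ {n} (w : Vector Carrier n) {a : Vector Carrier n} → (∀ i → a i ≈ 0#) → dot w a ≈ 0#
  dot-zero w a≈0 = sum-zero +-commutativeMonoid _ (λ i → trans (*-congˡ (a≈0 i)) (zeroʳ (w i)))

  dot-+ : ∀ {n} (w a b : Vector Carrier n) → dot w (λ i → a i + b i) ≈ dot w a + dot w b
  dot-+ w a b = trans (sum-cong-≋ (λ i → distribˡ (w i) (a i) (b i)))
    (∑-distrib-+ (λ i → w i * a i) (λ i → w i * b i))

  dot-* : ∀ {n} (w : Vector Carrier n) s a → dot w (λ i → s * a i) ≈ s * dot w a
  dot-* w s a = trans (sum-cong-≋ (λ i → x∙yz≈y∙xz (w i) s (a i)))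
    (sym (*-distribˡ-sum s (λ i → w i * a i)))

  dot-support : ∀ {k n} {g : Fin k → Fin n} → Injective _≡_ _≡_ g → ∀ w a →
    (∀ i → (∀ j → g j ≢ i) → a i ≈ 0#) → dot w a ≈ dot (w ∘ g) (a ∘ g)
  dot-support g-inj w a a≈0 = sum-support +-commutativeMonoid g-inj _
    (λ i g≢i → trans (*-congˡ (a≈0 i g≢i)) (zeroʳ (w i)))

diagonal-not-far : ∀ {n} (i : Fin n) → ¬ 2 ℕ.+ toℕ i ≤ toℕ i
diagonal-not-far i = ℕ.<⇒≱ (ℕ.m≤n+m (suc (toℕ i)) 1)

superdiagonal-not-far : ∀ {n} (i : Fin n) → ¬ 2 ℕ.+ toℕ (inject₁ i) ≤ suc (toℕ i)
superdiagonal-not-far i 2+i≤1+i =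
  ℕ.<⇒≱ ℕ.≤-refl (≡.subst (λ k → 2 ℕ.+ k ≤ suc (toℕ i)) (Fin.toℕ-inject₁ i) 2+i≤1+i)

module Code {c ℓ₁ ℓ₂ q} (𝔽 : FiniteField c ℓ₁ ℓ₂ q) (1<q : 1 < q)
            {m : ℕ} (C : FlagRank.Configuration 𝔽 m) where
  open FiniteField 𝔽
  open CommutativeRing commutativeRing hiding (zero; _-_)
  open CommutativeSemigroupProperties +-commutativeSemigroup using (interchange)
  open FiniteDimension 𝔽 using (_≟_)
  open FlagRank 𝔽
  open Point
  open Configuration C
  open FiniteFieldLinearAlgebra 𝔽
  open FlagRankBounds 𝔽 1<q
  open DotProduct commutativeRing
  open SemiringSolver commutativeSemiring using (solve; _:+_; _:*_; _:=_; con)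

  u : Fin (suc m) → Vector Carrier 3
  u i = rep (P i)

  v : Fin m → Vector Carrier 3
  v i = rep (Q i)

  diagonal : Matrix (suc m) (suc m) → Vector Carrier (suc m)
  diagonal A i = A i i

  superdiagonal : Matrix (suc m) (suc m) → Vector Carrier m
  superdiagonal A i = A (inject₁ i) (suc i)

  -- This is `H` applied to `ρ A`, with the diagonal and superdiagonal contributions separated. The
  -- interleaved order of the columns matters only in `interleave-dot`.
  syndrome : Matrix (suc m) (suc m) → Vector Carrier 3
  syndrome A r = dot (λ i → u i r) (diagonal A) + dot (λ i → v i r) (superdiagonal A)

  interleave-dot : ∀ {k} (x : Vector (Vector Carrier 3) (suc k)) y (a : Vector Carrier (suc k)) b r →
    dot (λ j → interleave x y j r) (interleave a b) ≈ dot (λ i → x i r) a + dot (λ i → y i r) b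
  interleave-dot {zero}  x y a b r = sym (+-identityʳ _)
  interleave-dot {suc k} x y a b r = trans
    (+-congˡ (+-congˡ (interleave-dot (x ∘ suc) (y ∘ suc) (a ∘ suc) (b ∘ suc) r)))
    (solve 4 (λ s t S T → s :+ (t :+ (S :+ T)) := (s :+ S) :+ (t :+ T)) refl _ _ _ _)

  -- The parity-check form of `𝒟`, free of the existential decomposition. All properties are proved
  -- for `𝒦` and carried over by the two inclusions below.
  𝒦 : Pred (Matrix (suc m) (suc m)) ℓ₁
  𝒦 A = A ∈ U (suc m) × (∀ r → syndrome A r ≈ 0#)

  ρ∈ker⇔ : ∀ A r → dot (H C r) (ρ A) ≈ syndrome A r
  ρ∈ker⇔ A r = interleave-dot u v (diagonal A) (superdiagonal A) r

  open Module (Mat (suc m) (suc m)) using (_≈ᴹ_; _+ᴹ_; _*ₗ_; 0ᴹ)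
  open LinearAlgebra (Mat (suc m) (suc m)) using (IsSubspace)

  syndrome-cong : ∀ {A B} → A ≈ᴹ B → ∀ r → syndrome A r ≈ syndrome B r
  syndrome-cong A≈B r = +-cong
    (dot-cong (λ i → u i r) (λ i → A≈B i i))
    (dot-cong (λ i → v i r) (λ i → A≈B (inject₁ i) (suc i)))

  syndrome-+ : ∀ A B r → syndrome (A +ᴹ B) r ≈ syndrome A r + syndrome B r
  syndrome-+ A B r = trans (+-cong (dot-+ (λ i → u i r) (diagonal A) (diagonal B))
                                   (dot-+ (λ i → v i r) (superdiagonal A) (superdiagonal B)))
                           (interchange _ _ _ _)

  syndrome-* : ∀ s A r → syndrome (s *ₗ A) r ≈ s * syndrome A r
  syndrome-* s A r = trans (+-cong (dot-* (λ i → u i r) s (diagonal A))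
                                   (dot-* (λ i → v i r) s (superdiagonal A)))
                           (sym (distribˡ s _ _))

  syndrome-zero : ∀ {A} → (∀ i → A i i ≈ 0#) → (∀ i → A (inject₁ i) (suc i) ≈ 0#) →
    ∀ r → syndrome A r ≈ 0#
  syndrome-zero D≈0 S≈0 r = trans
    (+-cong (dot-zero (λ i → u i r) D≈0) (dot-zero (λ i → v i r) S≈0)) (+-identityʳ 0#)

  𝒦-isSubspace : IsSubspace 𝒦
  𝒦-isSubspace = record
    { resp     = λ A≈B (A∈U , A∈ker) →
        (λ i j j<i → trans (sym (A≈B i j)) (A∈U i j j<i)) ,
        (λ r → trans (sym (syndrome-cong A≈B r)) (A∈ker r))
    ; 0-closed = (λ _ _ _ → refl) , syndrome-zero {0ᴹ} (λ _ → refl) (λ _ → refl)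
    ; +-closed = λ {A} {B} (A∈U , A∈ker) (B∈U , B∈ker) →
        (λ i j j<i → trans (+-cong (A∈U i j j<i) (B∈U i j j<i)) (+-identityʳ 0#)) ,
        (λ r → trans (syndrome-+ A B r) (trans (+-cong (A∈ker r) (B∈ker r)) (+-identityʳ 0#)))
    ; *-closed = λ s {A} (A∈U , A∈ker) →
        (λ i j j<i → trans (*-congˡ (A∈U i j j<i)) (zeroʳ s)) ,
        (λ r → trans (syndrome-* s A r) (trans (*-congˡ (A∈ker r)) (zeroʳ s)))
    }

  𝒟⊆𝒦 : 𝒟 C ⊆ 𝒦
  𝒟⊆𝒦 {X} (Y , Z , ((Y∈U , _) , Y∈ker) , (Z∈U , Z≈0) , X≈Y+Z) =
    IsSubspace.resp 𝒦-isSubspace {Y +ᴹ Z} {X} (λ i j → sym (X≈Y+Z i j))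
      (IsSubspace.+-closed 𝒦-isSubspace {Y} {Z}
        (Y∈U , λ r → trans (sym (ρ∈ker⇔ Y r)) (Y∈ker r))
        (Z∈U , syndrome-zero {Z}
          (λ i → Z≈0 i i (diagonal-not-far i))
          (λ i → Z≈0 (inject₁ i) (suc i) (superdiagonal-not-far i))))

  -- The matrix is cut between the superdiagonal and the diagonals above it. The far part has
  -- syndrome zero, so the near part inherits the syndrome of `A`.
  𝒦⊆𝒟 : 𝒦 ⊆ 𝒟 C
  𝒦⊆𝒟 {A} (A∈U , A∈ker) = near , far ,
    ((near∈U , near-far) ,
      λ r → trans (ρ∈ker⇔ near r) (trans (sym (syndrome≈ r)) (A∈ker r))) ,
    ((far∈U , far-near) , split)
    where
    near far : Matrix (suc m) (suc m)
    near i j with 2 ℕ.+ toℕ i ℕ.≤? toℕ j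
    ... | yes _ = 0#
    ... | no  _ = A i j
    far i j with 2 ℕ.+ toℕ i ℕ.≤? toℕ j
    ... | yes _ = A i j
    ... | no  _ = 0#

    near-far : ∀ i j → 2 ℕ.+ toℕ i ≤ toℕ j → near i j ≈ 0#
    near-far i j 2+i≤j with 2 ℕ.+ toℕ i ℕ.≤? toℕ j
    ... | yes _ = refl
    ... | no 2+i≰j = contradiction 2+i≤j 2+i≰j

    far-near : ∀ i j → ¬ 2 ℕ.+ toℕ i ≤ toℕ j → far i j ≈ 0#
    far-near i j 2+i≰j with 2 ℕ.+ toℕ i ℕ.≤? toℕ j
    ... | yes 2+i≤j = contradiction 2+i≤j 2+i≰j
    ... | no _  = refl

    near∈U : near ∈ U (suc m)
    near∈U i j j<i with 2 ℕ.+ toℕ i ℕ.≤? toℕ j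
    ... | yes _ = refl
    ... | no _  = A∈U i j j<i

    far∈U : far ∈ U (suc m)
    far∈U i j j<i with 2 ℕ.+ toℕ i ℕ.≤? toℕ j
    ... | yes _ = A∈U i j j<i
    ... | no _  = refl

    split : ∀ i j → A i j ≈ near i j + far i j
    split i j with 2 ℕ.+ toℕ i ℕ.≤? toℕ j
    ... | yes _ = sym (+-identityˡ _)
    ... | no _  = sym (+-identityʳ _)

    syndrome≈ : ∀ r → syndrome A r ≈ syndrome near r
    syndrome≈ r = trans (syndrome-cong split r) (trans (syndrome-+ near far r)
      (trans (+-congˡ (syndrome-zero {far}
        (λ i → far-near i i (diagonal-not-far i))
        (λ i → far-near (inject₁ i) (suc i) (superdiagonal-not-far i)) r)) (+-identityʳ _)))

  -- The semiring solver knows no negation. Adding a multiple of a sum known to vanish lets a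
  -- negative coefficient be treated as a variable, so that only semiring identities remain to be
  -- solved.
  x+y≈0⇒z≈z+x+y*t : ∀ {x y} z t → x + y ≈ 0# → z ≈ z + (x + y) * t
  x+y≈0⇒z≈z+x+y*t z t eq = sym (trans (+-congˡ (trans (*-congʳ eq) (zeroˡ t))) (+-identityʳ z))

  -- Solving the relation for the representative of `X` gives `- (x′ * y)` times that of `Y`.
  scaled-point-⊆ : ∀ X Y {x y x′} → x′ * x ≈ 1# →
    (∀ r → rep X r * x + rep Y r * y ≈ 0#) → ⟨ X ⟩ ⊆ ⟨ Y ⟩
  scaled-point-⊆ X Y {x} {y} {x′} x′x≈1 rel (e , eX≈z) = (λ _ → k * y) , λ r →
    trans (+-congʳ (begin
      k * y * rep Y r
        ≈⟨ x+y≈0⇒z≈z+x+y*t _ _ (-‿inverseˡ (e zero * x′)) ⟩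
      k * y * rep Y r + (k + e zero * x′) * (x * rep X r)
        ≈⟨ solve 7 (λ k y q e x′ x p → k :* y :* q :+ (k :+ e :* x′) :* (x :* p) :=
             k :* (p :* x :+ q :* y) :+ e :* (x′ :* x) :* p) refl _ _ _ _ _ _ _ ⟩
      k * (rep X r * x + rep Y r * y) + e zero * (x′ * x) * rep X r
        ≈⟨ +-cong (*-congˡ (rel r)) (*-congʳ (*-congˡ x′x≈1)) ⟩
      k * 0# + e zero * 1# * rep X r
        ≈⟨ +-cong (zeroʳ k) (*-congʳ (*-identityʳ _)) ⟩
      0# + e zero * rep X r
        ≈⟨ +-identityˡ _ ⟩
      e zero * rep X r ∎)) (eX≈z r)
    where
    open ≈-Reasoning setoid
    k = - (e zero * x′)

  -- Suppose `x` is nonzero. If `y` is nonzero too, each representative is a multiple of the other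
  -- and the points coincide; if `y` vanishes, `u i` is the zero vector.
  pair-independent : ∀ {i j} → i ≢ j → ∀ {x y} →
    (∀ r → u i r * x + u j r * y ≈ 0#) → x ≈ 0#
  pair-independent {i} {j} i≢j {x} {y} rel with x ≟ 0# | y ≟ 0#
  ... | yes x≈0 | _ = x≈0
  ... | no x≉0 | no y≉0 with _ , x′x≈1 ← x≉0⇒unit x≉0 | _ , y′y≈1 ← x≉0⇒unit y≉0 =
    ⊥-elim (distinct i j i≢j
      ( scaled-point-⊆ (P i) (P j) x′x≈1 rel
      , scaled-point-⊆ (P j) (P i) y′y≈1 (λ r → trans (+-comm _ _) (rel r))))
  ... | no x≉0 | yes y≈0 with x′ , x′x≈1 ← x≉0⇒unit x≉0 = contradiction
    (λ r → begin
      u i r                          ≈⟨ *-identityʳ _ ⟨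
      u i r * 1#                     ≈⟨ *-congˡ x′x≈1 ⟨
      u i r * (x′ * x)               ≈⟨ x∙yz≈y∙xz (u i r) x′ x ⟩
      x′ * (u i r * x)               ≈⟨ *-congˡ (+-identityʳ _) ⟨
      x′ * (u i r * x + 0#)          ≈⟨ *-congˡ (+-congˡ (trans (*-congˡ y≈0) (zeroʳ (u j r)))) ⟨
      x′ * (u i r * x + u j r * y)   ≈⟨ *-congˡ (rel r) ⟩
      x′ * 0#                        ≈⟨ zeroʳ x′ ⟩
      0#                             ∎)
    (nonzero (P i))
    where
    open ≈-Reasoning setoid
    open CommutativeSemigroupProperties *-commutativeSemigroup using (x∙yz≈y∙xz)

  -- If `z` is nonzero, solving for `v i` puts the point `Q i` on the line that it must avoid.
  -- Otherwise a relation between two distinct points is left.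
  triple-independent : ∀ i {x y z} →
    (∀ r → u (inject₁ i) r * x + u (suc i) r * y + v i r * z ≈ 0#) →
    x ≈ 0# × y ≈ 0# × z ≈ 0#
  triple-independent i {x} {y} {z} rel with z ≟ 0#
  ... | yes z≈0 =
    pair-independent i≢i+1 pair-rel ,
    pair-independent (i≢i+1 ∘ ≡.sym) (λ r → trans (+-comm _ _) (pair-rel r)) ,
    z≈0
    where
    i≢i+1 : inject₁ i ≢ suc i
    i≢i+1 eq = ℕ.1+n≢n (≡.trans (≡.sym (≡.cong toℕ eq)) (Fin.toℕ-inject₁ i))

    pair-rel : ∀ r → u (inject₁ i) r * x + u (suc i) r * y ≈ 0#
    pair-rel r = trans (sym (trans (+-congˡ (trans (*-congˡ z≈0) (zeroʳ _))) (+-identityʳ _))) (rel r)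
  ... | no z≉0 with z′ , z′z≈1 ← x≉0⇒unit z≉0 =
    -- An element `e zero * v i` of the point `Q i` is rewritten through `u (inject₁ i)` and
    -- `u (suc i)`; the factor `- (e zero * z′)` comes from dividing the relation by `z`.
    ⊥-elim (off-line i λ (e , eQ≈t) → let k = - (e zero * z′) in (k * x ∷ k * y ∷ []) , λ r → let
        p = u (inject₁ i) r
        s = u (suc i) r
        w = v i r
      in trans (begin
        k * x * p + (k * y * s + 0#)
          ≈⟨ x+y≈0⇒z≈z+x+y*t _ _ (-‿inverseˡ (e zero * z′)) ⟩
        k * x * p + (k * y * s + 0#) + (k + e zero * z′) * (z * w)
          ≈⟨ solve 9 (λ k x p y s e z′ z w →
               k :* x :* p :+ (k :* y :* s :+ con 0) :+ (k :+ e :* z′) :* (z :* w) :=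
               k :* (p :* x :+ s :* y :+ w :* z) :+ (e :* (z′ :* z) :* w :+ con 0))
               refl _ _ _ _ _ _ _ _ _ ⟩
        k * (p * x + s * y + w * z) + (e zero * (z′ * z) * w + 0#)
          ≈⟨ +-cong (*-congˡ (rel r)) (+-congʳ (*-congʳ (*-congˡ z′z≈1))) ⟩
        k * 0# + (e zero * 1# * w + 0#)
          ≈⟨ +-cong (zeroʳ k) (+-congʳ (*-congʳ (*-identityʳ _))) ⟩
        0# + (e zero * w + 0#)
          ≈⟨ +-identityˡ _ ⟩
        e zero * w + 0# ∎) (eQ≈t r))
    where open ≈-Reasoning setoid

-- Minimum distance and the ball of radius 1

data Position {m : ℕ} : Fin (suc m) → Fin (suc m) → Set where
  below      : ∀ {i j} → toℕ j < toℕ i → Position i j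
  diag       : ∀ i → Position i i
  superdiag  : ∀ i → Position (inject₁ i) (suc i)
  far        : ∀ {i j} → 2 ℕ.+ toℕ i ≤ toℕ j → Position i j

position : ∀ {m} (i j : Fin (suc m)) → Position i j
position i j with ℕ.<-cmp (toℕ i) (toℕ j)
... | tri> _ _ j<i = below j<i
... | tri≈ _ i≡j _ with ≡.refl ← Fin.toℕ-injective i≡j = diag i
... | tri< i<j _ _ with ℕ.m≤n⇒m<n∨m≡n i<j
...   | inj₁ 2+i≤j = far 2+i≤j
position i (suc j) | tri< _ _ _ | inj₂ 1+i≡1+j
  with ≡.refl ← Fin.toℕ-injective {i = i} {j = inject₁ j}
                  (≡.trans (ℕ.suc-injective 1+i≡1+j) (≡.sym (Fin.toℕ-inject₁ j))) = superdiag j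

inject₁<suc : ∀ {m} (i : Fin m) → toℕ (inject₁ i) < toℕ (suc i)
inject₁<suc i = s≤s (ℕ.≤-reflexive (Fin.toℕ-inject₁ i))

module MinimumDistance {c ℓ₁ ℓ₂ q} (𝔽 : FiniteField c ℓ₁ ℓ₂ q) (1<q : 1 < q)
                       {m : ℕ} (C : FlagRank.Configuration 𝔽 m) where
  open FiniteField 𝔽
  open CommutativeRing commutativeRing hiding (zero; _-_)
  open FiniteDimension 𝔽 using (_≟_)
  open FlagRank 𝔽
  open Configuration C
  open FiniteFieldLinearAlgebra 𝔽
  open FlagRankBounds 𝔽 1<q
  open DotProduct commutativeRing
  open Code 𝔽 1<q C
  open Module (Mat (suc m) (suc m)) using (_≈ᴹ_; 0ᴹ; ≈ᴹ-setoid)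
  open LinearAlgebra (Mat (suc m) (suc m)) using (HasSize)

  module _ (M : Matrix (suc m) (suc m)) where

    -- A witness that the block `M [ k ]` is nonzero, in the form that `flag-rank-lower-bound`
    -- takes.
    MeetsFlag : Fin (suc m) → Set ℓ₁
    MeetsFlag k = ∃₂ λ i j → ¬ M i j ≈ 0# × toℕ i ≤ toℕ k × toℕ k ≤ toℕ j

    diagonal-meets : ∀ {k} → ¬ M k k ≈ 0# → MeetsFlag k
    diagonal-meets Mkk≉0 = _ , _ , Mkk≉0 , ℕ.≤-refl , ℕ.≤-refl

    two-flags : ∀ {i j} → i ≢ j → MeetsFlag i → MeetsFlag j → 2 ≤ fr M
    two-flags i≢j hi hj = flag-rank-lower-bound M (pair-injective i≢j)
      λ { zero → hi ; (suc zero) → hj }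

    three-flags : ∀ {i j k} → i ≢ j → i ≢ k → j ≢ k →
      MeetsFlag i → MeetsFlag j → MeetsFlag k → 3 ≤ fr M
    three-flags i≢j i≢k j≢k hi hj hk =
      flag-rank-lower-bound M (triple-injective i≢j i≢k j≢k)
        λ { zero → hi ; (suc zero) → hj ; (suc (suc zero)) → hk }

  module _ {M : Matrix (suc m) (suc m)} (M∈𝒦 : M ∈ 𝒦) (fr≤2 : ¬ 3 ≤ fr M) where

    -- A nonzero entry here would lie in the three blocks with indices `i`, `i + 1` and `j`.
    far-zero : ∀ i j → 2 ℕ.+ toℕ i ≤ toℕ j → M i j ≈ 0#
    far-zero i j 2+i≤j = decidable-stable (M i j ≟ 0#) λ Mij≉0 → fr≤2
      (three-flags M (Fin.<⇒≢ i<k) (Fin.<⇒≢ (ℕ.<-trans i<k k<j)) (Fin.<⇒≢ k<j)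
        (i , j , Mij≉0 , ℕ.≤-refl , ℕ.<⇒≤ (ℕ.<-trans i<k k<j))
        (i , j , Mij≉0 , ℕ.<⇒≤ i<k , ℕ.<⇒≤ k<j)
        (i , j , Mij≉0 , ℕ.<⇒≤ (ℕ.<-trans i<k k<j) , ℕ.≤-refl))
      where
      1+i<n = ℕ.<-trans 2+i≤j (Fin.toℕ<n j)
      k = fromℕ< 1+i<n
      i<k : toℕ i < toℕ k
      i<k = ℕ.≤-reflexive (≡.sym (Fin.toℕ-fromℕ< 1+i<n))
      k<j : toℕ k < toℕ j
      k<j = ℕ.≤-trans (s≤s (ℕ.≤-reflexive (Fin.toℕ-fromℕ< 1+i<n))) 2+i≤j

    -- A nonzero entry here already meets the blocks `i` and `i + 1`, so no other block may be met.
    -- The syndrome then reduces to a relation between `u (inject₁ i)`, `u (suc i)` and `v i`.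
    superdiagonal-zero : ∀ i → M (inject₁ i) (suc i) ≈ 0#
    superdiagonal-zero i = decidable-stable (M (inject₁ i) (suc i) ≟ 0#) λ Mi≉0 →
      let
        i<i+1 = inject₁<suc i

        third-flag : ∀ {k} → inject₁ i ≢ k → suc i ≢ k → ¬ MeetsFlag M k
        third-flag i≢k i+1≢k hk = fr≤2 (three-flags M (Fin.<⇒≢ i<i+1) i≢k i+1≢k
          (_ , _ , Mi≉0 , ℕ.≤-refl , ℕ.<⇒≤ i<i+1)
          (_ , _ , Mi≉0 , ℕ.<⇒≤ i<i+1 , ℕ.≤-refl) hk)

        diagonal≈0 : ∀ k → (∀ a → (inject₁ i ∷ suc i ∷ []) a ≢ k) → M k k ≈ 0#
        diagonal≈0 k k∉ = decidable-stable (M k k ≟ 0#) λ Mkk≉0 →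
          third-flag (k∉ zero) (k∉ (suc zero)) (diagonal-meets M Mkk≉0)

        superdiagonal≈0 : ∀ k → (∀ a → (i ∷ []) a ≢ k) → M (inject₁ k) (suc k) ≈ 0#
        superdiagonal≈0 k k∉ = decidable-stable (M (inject₁ k) (suc k) ≟ 0#) λ Mk≉0 →
          other Mk≉0 third-flag (Fin.<-cmp i k) (k∉ zero)

        relation : ∀ r → u (inject₁ i) r * M (inject₁ i) (inject₁ i) +
          u (suc i) r * M (suc i) (suc i) + v i r * M (inject₁ i) (suc i) ≈ 0#
        relation r = trans (sym (+-cong
          (trans (dot-support (pair-injective (Fin.<⇒≢ i<i+1)) (λ k → u k r) (diagonal M) diagonal≈0)
            (+-congˡ (+-identityʳ _)))
          (trans (dot-support [ i ]-injective (λ k → v k r) (superdiagonal M) superdiagonal≈0)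
            (+-identityʳ _)))) (proj₂ M∈𝒦 r)
      in Mi≉0 (proj₂ (proj₂ (triple-independent i relation)))
      where
      -- A second superdiagonal entry, with index `k`, meets a block outside the pair: `suc k` when
      -- it lies to the right of `i`, `inject₁ k` when it lies to the left.
      other : ∀ {k} → ¬ M (inject₁ k) (suc k) ≈ 0# →
        (∀ {k} → inject₁ i ≢ k → suc i ≢ k → ¬ MeetsFlag M k) →
        Tri (toℕ i < toℕ k) (i ≡ k) (toℕ k < toℕ i) → i ≢ k → ⊥
      other {k} Mk≉0 third-flag (tri< i<k _ _) i≢k = third-flag {suc k}
        (Fin.<⇒≢ (ℕ.<-trans (inject₁<suc i) (s≤s i<k))) (Fin.<⇒≢ (s≤s i<k))
        (_ , _ , Mk≉0 , ℕ.<⇒≤ (inject₁<suc k) , ℕ.≤-refl)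
      other {k} Mk≉0 third-flag (tri≈ _ i≡k _) i≢k = i≢k i≡k
      other {k} Mk≉0 third-flag (tri> _ _ k<i) i≢k = third-flag {inject₁ k}
        (Fin.<⇒≢ k<i′ ∘ ≡.sym) (Fin.<⇒≢ (ℕ.<-trans k<i′ (inject₁<suc i)) ∘ ≡.sym)
        (_ , _ , Mk≉0 , ℕ.≤-refl , ℕ.<⇒≤ (inject₁<suc k))
        where
        k<i′ : toℕ (inject₁ k) < toℕ (inject₁ i)
        k<i′ = ≡.subst₂ _<_ (≡.sym (Fin.toℕ-inject₁ k)) (≡.sym (Fin.toℕ-inject₁ i)) k<i

    -- The superdiagonal is already known to vanish, so the syndrome is a relation between two
    -- distinct points.
    relation-on-pair : ∀ {i j} → i ≢ j → (∀ k → i ≢ k → j ≢ k → M k k ≈ 0#) → M i i ≈ 0#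
    relation-on-pair {i} {j} i≢j elsewhere = pair-independent i≢j λ r → trans (sym (trans
      (+-cong (trans (dot-support (pair-injective i≢j) (λ k → u k r) (diagonal M)
                       (λ k k∉ → elsewhere k (k∉ zero) (k∉ (suc zero))))
                (+-congˡ (+-identityʳ _)))
              (dot-zero (λ k → v k r) superdiagonal-zero))
      (+-identityʳ _))) (proj₂ M∈𝒦 r)

    -- If some other diagonal entry is nonzero, a third one would exceed the weight, so these two
    -- carry the whole diagonal. If none is, any second index completes the pair.
    diagonal-zero : ∀ i → M i i ≈ 0#
    diagonal-zero i with Fin.any? (λ j → ¬? (i Fin.≟ j) ×-dec ¬? (M j j ≟ 0#))
    ... | yes (j , i≢j , Mjj≉0) = decidable-stable (M i i ≟ 0#) λ Mii≉0 →
      Mii≉0 (relation-on-pair i≢j λ k i≢k j≢k → decidable-stable (M k k ≟ 0#) λ Mkk≉0 →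
        fr≤2 (three-flags M i≢j i≢k j≢k (diagonal-meets M Mii≉0) (diagonal-meets M Mjj≉0)
          (diagonal-meets M Mkk≉0)))
    ... | no none = relation-on-pair (proj₂ other) λ k i≢k _ →
      decidable-stable (M k k ≟ 0#) λ Mkk≉0 → none (k , i≢k , Mkk≉0)
      where
      other : ∃[ j ] i ≢ j
      other = punchIn i (fromℕ< (ℕ.≤-trans ℕ.z<s (ℕ.s≤s⁻¹ 3≤n))) , Fin.punchInᵢ≢i i _ ∘ ≡.sym

    light⇒zero : M ≈ᴹ 0ᴹ
    light⇒zero i j with position i j
    ... | below j<i   = proj₁ M∈𝒦 i j j<i
    ... | diag i      = diagonal-zero i
    ... | superdiag i = superdiagonal-zero i
    ... | far 2+i≤j   = far-zero i j 2+i≤j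

  minimum-weight : ∀ {M} → M ∈ 𝒦 → ¬ M ≈ᴹ 0ᴹ → 3 ≤ fr M
  minimum-weight {M} M∈𝒦 M≉0 = decidable-stable (3 ℕ.≤? fr M) (M≉0 ∘ light⇒zero M∈𝒦)

  E∈U : ∀ i j x → toℕ i ≤ toℕ j → E i j x ∈ U (suc m)
  E∈U i j x i≤j r s s<r = reflexive (E-off i j x r s λ { (≡.refl , ≡.refl) → ℕ.<⇒≱ s<r i≤j })

  far-E∈𝒦 : ∀ i j x → 2 ℕ.+ toℕ i ≤ toℕ j → E i j x ∈ 𝒦
  far-E∈𝒦 i j x 2+i≤j = E∈U i j x (ℕ.≤-trans (ℕ.m≤n+m (toℕ i) 2) 2+i≤j) , syndrome-zero {E i j x}
    (λ k → reflexive (E-off i j x k k λ { (≡.refl , ≡.refl) → diagonal-not-far k 2+i≤j }))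
    (λ k → reflexive (E-off i j x (inject₁ k) (suc k) λ { (≡.refl , ≡.refl) →
      superdiagonal-not-far k 2+i≤j }))

  Eᵢⱼ≉0 : ∀ i j {x} → ¬ x ≈ 0# → ¬ E i j x ≈ᴹ 0ᴹ
  Eᵢⱼ≉0 i j {x} x≉0 E≈0 = x≉0 (trans (reflexive (≡.sym (E-at i j x))) (E≈0 i j))

  -- An off-diagonal entry, or two diagonal ones, would meet two blocks, so weight at most 1 leaves
  -- at most one diagonal entry. The zero matrix is numbered first, then the pairs of a diagonal
  -- place and one of the `q′` nonzero scalars.
  ball-size : ∀ {q′} → q ≡ suc q′ → HasSize (Ball {suc m} 1) (suc (suc m ℕ.* q′))
  ball-size {q′} ≡.refl = enumeration⇒cardinality (On.setoid ≈ᴹ-setoid (proj₁ {B = Ball {suc m} 1}))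
    (λ a → word a , word∈ball a) ball-injective (λ (A , A∈U , fr≤1) → ball-covers A∈U fr≤1)
    where
    ζ : Fin (suc q′)
    ζ = Enum.to 0#

    -- Skipping the index `ζ` of 0 leaves exactly the nonzero scalars.
    scalar : Fin q′ → Carrier
    scalar l = Enum.from (punchIn ζ l)

    scalar≉0 : ∀ l → ¬ scalar l ≈ 0#
    scalar≉0 l eq = Fin.punchInᵢ≢i ζ l (≡.trans (≡.sym (Enum.strictlyInverseˡ _)) (Enum.to-cong eq))

    line : Fin (suc m) → Fin q′ → Matrix (suc m) (suc m)
    line k l = E k k (scalar l)

    place : Fin (suc m ℕ.* q′) → Fin (suc m)
    place a = proj₁ (remQuot {suc m} q′ a)

    letter : Fin (suc m ℕ.* q′) → Fin q′
    letter a = proj₂ (remQuot {suc m} q′ a)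

    word : Fin (suc (suc m ℕ.* q′)) → Matrix (suc m) (suc m)
    word zero    = 0ᴹ
    word (suc a) = line (place a) (letter a)

    fr-line : ∀ k x → fr (E k k x) ≤ 1
    fr-line k x = fr-E-bound [ k ]-injective k k x λ i k∉ (k≤i , i≤k) →
      k∉ zero (Fin.toℕ-injective (ℕ.≤-antisym k≤i i≤k))

    word∈ball : ∀ a → word a ∈ Ball 1
    word∈ball zero = (λ _ _ _ → refl) , ℕ.≤-trans (ℕ.≤-reflexive fr-0≡0) z≤n
      where
      fr-0≡0 : fr {suc m} 0ᴹ ≡ 0
      fr-0≡0 = sum-zero ℕ.+-0-commutativeMonoid (λ k → rk (0ᴹ [ k ])) λ k →
        ℕ.n≤0⇒n≡0 (rk-bound (0ᴹ [ k ]) [] (λ s → (λ ()) , λ _ → refl))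
    word∈ball (suc a) = E∈U (place a) (place a) x ℕ.≤-refl , fr-line (place a) x
      where x = scalar (letter a)

    line-injective : ∀ k l k′ l′ → line k l ≈ᴹ line k′ l′ → k ≡ k′ × l ≡ l′
    line-injective k l k′ l′ eq with k′ Fin.≟ k
    ... | yes ≡.refl = ≡.refl , Fin.punchIn-injective ζ l l′ (from-injective
      (trans (reflexive (≡.sym (E-at k k (scalar l))))
        (trans (eq k k) (reflexive (E-at k k (scalar l′))))))
    ... | no k′≢k = contradiction
      (trans (reflexive (≡.sym (E-at k k (scalar l)))) (trans (eq k k)
        (reflexive (E-off k′ k′ (scalar l′) k k λ (k′≡k , _) → k′≢k k′≡k))))
      (scalar≉0 l)

    ball-injective : ∀ {a b} → word a ≈ᴹ word b → a ≡ b
    ball-injective {zero}  {zero}  _  = ≡.refl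
    ball-injective {zero}  {suc b} eq =
      ⊥-elim (Eᵢⱼ≉0 (place b) (place b) (scalar≉0 (letter b)) λ i j → sym (eq i j))
    ball-injective {suc a} {zero}  eq = ⊥-elim (Eᵢⱼ≉0 (place a) (place a) (scalar≉0 (letter a)) eq)
    ball-injective {suc a} {suc b} eq
      with k≡ , l≡ ← line-injective (place a) (letter a) (place b) (letter b) eq = ≡.cong suc
      (≡.trans (≡.sym (Fin.combine-remQuot {suc m} q′ a)) (≡.trans (≡.cong₂ combine k≡ l≡)
        (Fin.combine-remQuot {suc m} q′ b)))

    module _ {A} (A∈U : A ∈ U (suc m)) (fr≤1 : fr A ≤ 1) where

      off-diagonal-zero : ∀ {i j} → i ≢ j → A i j ≈ 0#
      off-diagonal-zero {i} {j} i≢j with ℕ.<-cmp (toℕ i) (toℕ j)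
      ... | tri≈ _ i≡j _ = contradiction (Fin.toℕ-injective i≡j) i≢j
      ... | tri> _ _ j<i = A∈U i j j<i
      ... | tri< i<j _ _ = decidable-stable (A i j ≟ 0#) λ Aij≉0 → ℕ.<⇒≱
        (two-flags A i≢j (i , j , Aij≉0 , ℕ.≤-refl , ℕ.<⇒≤ i<j)
                         (i , j , Aij≉0 , ℕ.<⇒≤ i<j , ℕ.≤-refl)) fr≤1

      ball-covers : ∃[ a ] word a ≈ᴹ A
      ball-covers with Fin.any? (λ k → ¬? (A k k ≟ 0#))
      ... | no diagonal≈0 = zero , λ i j → sym (entry i j)
        where
        entry : ∀ i j → A i j ≈ 0#
        entry i j with i Fin.≟ j
        ... | yes ≡.refl = decidable-stable (A i i ≟ 0#) λ Aii≉0 → diagonal≈0 (i , Aii≉0)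
        ... | no i≢j = off-diagonal-zero i≢j
      ... | yes (k , Akk≉0) = suc (combine k l) , entry
        where
        ζ≢ : ζ ≢ Enum.to (A k k)
        ζ≢ eq = Akk≉0 (trans (sym (Enum.strictlyInverseʳ _))
          (trans (Enum.from-cong (≡.sym eq)) (Enum.strictlyInverseʳ _)))

        l : Fin q′
        l = punchOut ζ≢

        scalar-l : scalar l ≈ A k k
        scalar-l = trans (Enum.from-cong (Fin.punchIn-punchOut ζ≢)) (Enum.strictlyInverseʳ _)

        line≈A : line k l ≈ᴹ A
        line≈A i j with k Fin.≟ i | k Fin.≟ j
        ... | yes ≡.refl | yes ≡.refl = scalar-l
        ... | yes ≡.refl | no k≢j     = sym (off-diagonal-zero k≢j)
        ... | no k≢i     | _ with i Fin.≟ j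
        ...   | no i≢j     = sym (off-diagonal-zero i≢j)
        ...   | yes ≡.refl = sym (decidable-stable (A i i ≟ 0#) λ Aii≉0 → ℕ.<⇒≱
                  (two-flags A k≢i (diagonal-meets A Akk≉0) (diagonal-meets A Aii≉0)) fr≤1)

        entry : word (suc (combine k l)) ≈ᴹ A
        entry i j = trans (reflexive (≡.cong (λ (k , l) → line k l i j) (Fin.remQuot-combine k l)))
          (line≈A i j)

-- Counting the free positions

-- The positions (i, j), i ≤ j, 2 ≤ j (0-based), of a (2 + k) × (2 + k) matrix are
-- enumerated column by column.
freeCount : ℕ → ℕ
freeCount zero    = 0
freeCount (suc k) = freeCount k ℕ.+ (3 ℕ.+ k)

freePosition : ∀ k → Fin (freeCount k) → Fin (2 ℕ.+ k) × Fin (2 ℕ.+ k)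
freePosition (suc k) a with splitAt (freeCount k) a
... | inj₁ b = inject₁ (proj₁ (freePosition k b)) , inject₁ (proj₂ (freePosition k b))
... | inj₂ r = r , fromℕ (2 ℕ.+ k)

-- The last column and the earlier ones cannot collide, because `fromℕ` is not in the image of
-- `inject₁`.
freePosition-injective : ∀ k {a b} → freePosition k a ≡ freePosition k b → a ≡ b
freePosition-injective (suc k) {a} {b} eq
  with splitAt (freeCount k) a in eqa | splitAt (freeCount k) b in eqb
... | inj₁ a′ | inj₁ b′ =
  ≡.trans (≡.sym (Fin.splitAt⁻¹-↑ˡ eqa)) (≡.trans (≡.cong (_↑ˡ (3 ℕ.+ k))
    (freePosition-injective k (≡.cong₂ _,_ (Fin.inject₁-injective (≡.cong proj₁ eq))
                                           (Fin.inject₁-injective (≡.cong proj₂ eq)))))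
    (Fin.splitAt⁻¹-↑ˡ eqb))
... | inj₁ a′ | inj₂ s  = contradiction (≡.sym (≡.cong proj₂ eq)) Fin.fromℕ≢inject₁
... | inj₂ r  | inj₁ b′ = contradiction (≡.cong proj₂ eq) Fin.fromℕ≢inject₁
... | inj₂ r  | inj₂ s  =
  ≡.trans (≡.sym (Fin.splitAt⁻¹-↑ʳ eqa)) (≡.trans (≡.cong (freeCount k ↑ʳ_) (≡.cong proj₁ eq))
    (Fin.splitAt⁻¹-↑ʳ eqb))

freePosition-upper : ∀ k a →
  toℕ (proj₁ (freePosition k a)) ≤ toℕ (proj₂ (freePosition k a))
freePosition-upper (suc k) a with splitAt (freeCount k) a
... | inj₁ b = ≡.subst₂ _≤_ (≡.sym (Fin.toℕ-inject₁ _)) (≡.sym (Fin.toℕ-inject₁ _))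
                 (freePosition-upper k b)
... | inj₂ r = Fin.≤fromℕ r

2≤freePosition : ∀ k a → 2 ≤ toℕ (proj₂ (freePosition k a))
2≤freePosition (suc k) a with splitAt (freeCount k) a
... | inj₁ b = ≡.subst (2 ≤_) (≡.sym (Fin.toℕ-inject₁ _)) (2≤freePosition k b)
... | inj₂ r = ≡.subst (2 ≤_) (≡.sym (Fin.toℕ-fromℕ (2 ℕ.+ k))) (s≤s (s≤s z≤n))

freePosition-covers : ∀ k i j → toℕ i ≤ toℕ j → 2 ≤ toℕ j → ∃[ a ] freePosition k a ≡ (i , j)
freePosition-covers zero    i j i≤j 2≤j = contradiction 2≤j (ℕ.<⇒≱ (Fin.toℕ<n j))
freePosition-covers (suc k) i j i≤j 2≤j with view j
... | ‵fromℕ = freeCount k ↑ʳ i , lemma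
  where
  lemma : freePosition (suc k) (freeCount k ↑ʳ i) ≡ (i , fromℕ (2 ℕ.+ k))
  lemma rewrite Fin.splitAt-↑ʳ (freeCount k) (3 ℕ.+ k) i = ≡.refl
... | ‵inject₁ j′ with view i
-- Outside the last column, the last row lies below the diagonal.
...   | ‵fromℕ = contradiction
  (≡.subst₂ _≤_ (Fin.toℕ-fromℕ _) (Fin.toℕ-inject₁ j′) i≤j) (ℕ.<⇒≱ (Fin.toℕ<n j′))
...   | ‵inject₁ i′ with a , eq ← freePosition-covers k i′ j′
        (≡.subst₂ _≤_ (Fin.toℕ-inject₁ i′) (Fin.toℕ-inject₁ j′) i≤j)
        (≡.subst (2 ≤_) (Fin.toℕ-inject₁ j′) 2≤j) = a ↑ˡ (3 ℕ.+ k) , lemma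
  where
  lemma : freePosition (suc k) (a ↑ˡ (3 ℕ.+ k)) ≡ (inject₁ i′ , inject₁ j′)
  lemma rewrite Fin.splitAt-↑ˡ (freeCount k) a (3 ℕ.+ k) | eq = ≡.refl

-- The induction is run on the doubled identity, which is polynomial; the division by 2 is done once
-- at the end. The summand 3 accounts for the corner positions (0, 0), (0, 1) and (1, 1).
freeCount+3 : ∀ k → (2 ℕ.+ k) ℕ.* suc (2 ℕ.+ k) / 2 ≡ freeCount k ℕ.+ 3
freeCount+3 k = ≡.trans (≡.cong (_/ 2) (≡.sym (doubled k))) (m*n/n≡m (freeCount k ℕ.+ 3) 2)
  where
  open ℕ-Solver.+-*-Solver
  doubled : ∀ k → (freeCount k ℕ.+ 3) ℕ.* 2 ≡ (2 ℕ.+ k) ℕ.* (3 ℕ.+ k)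
  doubled zero    = ≡.refl
  doubled (suc k) = ≡.trans
    (solve 2 (λ f k → (f :+ (con 3 :+ k) :+ con 3) :* con 2 :=
       (f :+ con 3) :* con 2 :+ (con 3 :+ k) :* con 2) ≡.refl (freeCount k) k)
    (≡.trans (≡.cong (ℕ._+ (3 ℕ.+ k) ℕ.* 2) (doubled k))
      (solve 1 (λ k → (con 2 :+ k) :* (con 3 :+ k) :+ (con 3 :+ k) :* con 2 :=
         (con 3 :+ k) :* (con 4 :+ k)) ≡.refl k))

-- Dimension of the code

module Dimension {c ℓ₁ ℓ₂ q} (𝔽 : FiniteField c ℓ₁ ℓ₂ q) (1<q : 1 < q) where
  open FiniteField 𝔽
  open CommutativeRing commutativeRing hiding (zero; _-_)
  open FlagRank 𝔽
  open FiniteFieldLinearAlgebra 𝔽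
  open FlagRankBounds 𝔽 1<q
  open DotProduct commutativeRing

  module _ {n : ℕ} where
    open Module (Mat n n) using (_≈ᴹ_; 0ᴹ)
    open LinearAlgebra (Mat n n)

    combination-entry : ∀ {d} c (b : Vector (Matrix n n) d) i j →
      combination c b i j ≈ dot c (λ l → b l i j)
    combination-entry {zero}  c b i j = refl
    combination-entry {suc d} c b i j = +-congˡ (combination-entry (c ∘ suc) (b ∘ suc) i j)

    -- At the chosen positions the family `b` is a dual basis, which gives independence. For
    -- spanning, `A` minus the combination with the entries of `A` as coefficients vanishes at all
    -- these positions, hence is zero by `determined`.
    coordinates⇒dimension : ∀ {p} {S : Pred (Matrix n n) p} → IsSubspace S →
      ∀ {d} (row column : Fin d → Fin n) (b : Vector (Matrix n n) d) → (∀ l → b l ∈ S) →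
      (∀ l → b l (row l) (column l) ≈ 1#) →
      (∀ l l′ → l ≢ l′ → b l (row l′) (column l′) ≈ 0#) →
      (∀ {A} → A ∈ S → (∀ l → A (row l) (column l) ≈ 0#) → A ≈ᴹ 0ᴹ) →
      HasDimension S d
    coordinates⇒dimension {S = S} S≤V {d} row column b b∈S b₁ b₀ determined =
      b , independent , span⊆S , S⊆span
      where
      coordinate : ∀ c l → combination c b (row l) (column l) ≈ c l
      coordinate c l = trans (combination-entry c b (row l) (column l))
        (trans (dot-support [ l ]-injective c (λ l′ → b l′ (row l) (column l))
                 (λ l′ l≢l′ → b₀ l′ l (l≢l′ zero ∘ ≡.sym)))
          (trans (+-identityʳ _) (trans (*-congˡ (b₁ l)) (*-identityʳ (c l)))))

      independent : LinearlyIndependent b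
      independent c cb≈0 l = trans (sym (coordinate c l)) (cb≈0 (row l) (column l))

      span⊆S : Span b ⊆ S
      span⊆S (c , cb≈A) = IsSubspace.resp S≤V cb≈A (combination-closed (Mat n n) S≤V c b∈S)

      S⊆span : S ⊆ Span b
      S⊆span {A} A∈S = a , λ i j → sym (x+-1*y≈0⇒x≈y (Mat n n) {A} {B} (determined
        (IsSubspace.+-closed S≤V A∈S (IsSubspace.*-closed S≤V (- 1#) (span⊆S (a , λ i j → refl))))
        λ l → trans (+-congˡ (*-congˡ (coordinate a l))) (x+-1*x≈0 (𝔽^ 1) (λ _ → a l) zero)) i j)
        where
        a : Vector Carrier d
        a l = A (row l) (column l)

        B : Matrix n n
        B = combination a b

  module _ {k : ℕ} (C : Configuration (suc k)) where
    open Code 𝔽 1<q C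
    open MinimumDistance 𝔽 1<q C
    open Module (Mat (2 ℕ.+ k) (2 ℕ.+ k)) using (_≈ᴹ_; 0ᴹ)
    open LinearAlgebra (Mat (2 ℕ.+ k) (2 ℕ.+ k)) using (HasDimension)
    open SemiringSolver commutativeSemiring using (solve; _:+_; _:*_; _:=_; con)

    -- Columns are matched first, so that entries in the columns from 2 on
    -- reduce to those of A whatever the row is.
    patch : Matrix (2 ℕ.+ k) (2 ℕ.+ k) → Vector Carrier 3 → Matrix (2 ℕ.+ k) (2 ℕ.+ k)
    patch A x i             (suc (suc j)) = A i (suc (suc j))
    patch A x zero          zero          = x zero
    patch A x (suc i)       zero          = A (suc i) zero
    patch A x zero          (suc zero)    = x (suc (suc zero))
    patch A x (suc zero)    (suc zero)    = x (suc zero)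
    patch A x (suc (suc i)) (suc zero)    = A (suc (suc i)) (suc zero)

    patch-far : ∀ A x i j → 2 ≤ toℕ j → patch A x i j ≡ A i j
    patch-far A x i zero          ()
    patch-far A x i (suc zero)    (s≤s ())
    patch-far A x i (suc (suc j)) _ = ≡.refl

    patch∈U : ∀ {A} x → A ∈ U (2 ℕ.+ k) → patch A x ∈ U (2 ℕ.+ k)
    patch∈U x A∈U i             (suc (suc j)) j<i = A∈U i (suc (suc j)) j<i
    patch∈U x A∈U (suc i)       zero          j<i = A∈U (suc i) zero j<i
    patch∈U x A∈U (suc zero)    (suc zero)    (s≤s ())
    patch∈U x A∈U (suc (suc i)) (suc zero)    j<i = A∈U (suc (suc i)) (suc zero) j<i

    -- The order agrees with `patch`: the coefficients 0, 1, 2 are the entries at (0, 0), (1, 1) and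
    -- (0, 1).
    corner : Vector (Vector Carrier 3) 3
    corner = u zero ∷ u (suc zero) ∷ v zero ∷ []

    corner-independent : LinearAlgebra.LinearlyIndependent (𝔽^ 3) corner
    corner-independent x xc≈0 = λ
      { zero             → proj₁ x≈0
      ; (suc zero)       → proj₁ (proj₂ x≈0)
      ; (suc (suc zero)) → proj₂ (proj₂ x≈0)
      }
      where
      x≈0 = triple-independent zero λ r → trans
        (solve 6 (λ p x s y w z → p :* x :+ s :* y :+ w :* z :=
           x :* p :+ (y :* s :+ (z :* w :+ con 0))) refl _ _ _ _ _ _) (xc≈0 r)

    -- The corner entries contribute an arbitrary combination of a basis of the syndrome space, so
    -- they can be chosen to cancel the contribution `rest` of all other entries.
    correction : ∀ A → ∃[ x ] (∀ r → syndrome (patch A x) r ≈ 0#)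
    correction A = x , λ r → trans
      (solve 8 (λ p x s y D w z S → p :* x :+ (s :* y :+ D) :+ (w :* z :+ S) :=
         x :* p :+ (y :* s :+ (z :* w :+ con 0)) :+ (D :+ S)) refl _ _ _ _ _ _ _ _)
      (trans (+-congʳ (proj₂ solution r)) (-‿inverseˡ (rest r)))
      where
      rest : Vector Carrier 3
      rest r = dot (λ i → u (suc (suc i)) r) (λ i → diagonal A (suc (suc i)))
             + dot (λ i → v (suc i) r) (λ i → superdiagonal A (suc i))

      solution = independent⇒spanning {b = corner} corner-independent (λ r → - rest r)
      x = proj₁ solution

    row column : Fin (freeCount k) → Fin (2 ℕ.+ k)
    row l    = proj₁ (freePosition k l)
    column l = proj₂ (freePosition k l)

    -- Abstract, because the correction is found by an exhaustive search that
    -- conversion checking must not unfold.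
    abstract
      codeword : Fin (freeCount k) → Matrix (2 ℕ.+ k) (2 ℕ.+ k)
      codeword l = patch (E (row l) (column l) 1#) (proj₁ (correction (E (row l) (column l) 1#)))

      codeword∈𝒦 : ∀ l → codeword l ∈ 𝒦
      codeword∈𝒦 l = patch∈U _ (E∈U (row l) (column l) 1# (freePosition-upper k l)) ,
                     proj₂ (correction (E (row l) (column l) 1#))

      codeword-entry : ∀ l l′ →
        codeword l (row l′) (column l′) ≡ E (row l) (column l) 1# (row l′) (column l′)
      codeword-entry l l′ = patch-far _ _ (row l′) (column l′) (2≤freePosition k l′)

    module _ {A} (A∈𝒦 : A ∈ 𝒦) (free≈0 : ∀ l → A (row l) (column l) ≈ 0#) where

      outside-corner : ∀ i j → A i (suc (suc j)) ≈ 0#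
      outside-corner i j with toℕ i ℕ.≤? toℕ (suc (suc j))
      ... | no  i≰j = proj₁ A∈𝒦 i (suc (suc j)) (ℕ.≰⇒> i≰j)
      ... | yes i≤j with l , eq ← freePosition-covers k i (suc (suc j)) i≤j (s≤s (s≤s z≤n)) =
        trans (reflexive (≡.sym (≡.cong (λ (r , s) → A r s) eq))) (free≈0 l)

      -- With the columns from 2 on equal to zero, the syndrome only involves the corner and is the
      -- relation of `triple-independent` at index 0.
      corner-zero : A zero zero ≈ 0# × A (suc zero) (suc zero) ≈ 0# × A zero (suc zero) ≈ 0#
      corner-zero = triple-independent zero λ r → trans (sym (+-cong
        (trans (dot-support (pair-injective {x = zero} {y = suc zero} λ ()) (λ i → u i r) (diagonal A)
                 λ { zero          k∉ → contradiction ≡.refl (k∉ zero)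
                   ; (suc zero)    k∉ → contradiction ≡.refl (k∉ (suc zero))
                   ; (suc (suc i)) k∉ → outside-corner (suc (suc i)) i })
          (+-congˡ (+-identityʳ _)))
        (trans (dot-support [ zero ]-injective (λ i → v i r) (superdiagonal A)
                 λ { zero    k∉ → contradiction ≡.refl (k∉ zero)
                   ; (suc i) k∉ → outside-corner (suc (inject₁ i)) i })
          (+-identityʳ _)))) (proj₂ A∈𝒦 r)

      free-zero⇒zero : A ≈ᴹ 0ᴹ
      free-zero⇒zero i             (suc (suc j)) = outside-corner i j
      free-zero⇒zero zero          zero          = proj₁ corner-zero
      free-zero⇒zero zero          (suc zero)    = proj₂ (proj₂ corner-zero)
      free-zero⇒zero (suc zero)    (suc zero)    = proj₁ (proj₂ corner-zero)
      free-zero⇒zero (suc i)       zero          = proj₁ A∈𝒦 (suc i) zero (s≤s z≤n)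
      free-zero⇒zero (suc (suc i)) (suc zero)    = proj₁ A∈𝒦 (suc (suc i)) (suc zero) (s≤s (s≤s z≤n))

    codeword-at : ∀ l → codeword l (row l) (column l) ≈ 1#
    codeword-at l = reflexive (≡.trans (codeword-entry l l) (E-at (row l) (column l) 1#))

    codeword-off : ∀ l l′ → l ≢ l′ → codeword l (row l′) (column l′) ≈ 0#
    codeword-off l l′ l≢l′ = reflexive (≡.trans (codeword-entry l l′)
      (E-off (row l) (column l) 1# (row l′) (column l′) λ (r≡ , s≡) →
        l≢l′ (freePosition-injective k (≡.cong₂ _,_ r≡ s≡))))

    𝒦-dimension : HasDimension 𝒦 (freeCount k)
    𝒦-dimension = coordinates⇒dimension {S = 𝒦} 𝒦-isSubspace row column codeword codeword∈𝒦
      codeword-at codeword-off (λ {A} → free-zero⇒zero {A})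

    𝒟-dimension : HasDimension (𝒟 C) (freeCount k)
    𝒟-dimension with b , independent , b⊆𝒦 , 𝒦⊆b ← 𝒦-dimension =
      b , independent , (λ A∈b → 𝒦⊆𝒟 (b⊆𝒦 A∈b)) , (λ A∈𝒟 → 𝒦⊆b (𝒟⊆𝒦 A∈𝒟))

-- Sphere packing and the parameters of the code

open import Data.Nat using (_+_; _*_)

primePower>1 : ∀ {q} → IsPrimePower q → 1 < q
primePower>1 (p , k , p-prime , 1≤k , ≡.refl) =
  ℕ.^-monoʳ-< p (ℕ.nonTrivial⇒n>1 p {{prime⇒nonTrivial p-prime}}) 1≤k

-- The factorisation of `q ^ 3 - 1` as `(q - 1) * (q ^ 2 + q + 1)`, stated without subtraction.
sphere-packing : ∀ {n q q′} → n ≡ q ^ 2 + q + 1 → q ≡ suc q′ → suc (n * q′) ≡ q ^ 3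
sphere-packing {q′ = q′} ≡.refl ≡.refl = solve 1 (λ a → let b = con 1 :+ a in
    con 1 :+ (b :* (b :* con 1) :+ b :+ con 1) :* a := b :* (b :* (b :* con 1))) ≡.refl q′
  where open ℕ-Solver.+-*-Solver

module Parameters {c ℓ₁ ℓ₂ q} (𝔽 : FiniteField c ℓ₁ ℓ₂ q) (1<q : 1 < q)
                  {k : ℕ} (C : FlagRank.Configuration 𝔽 (suc k)) where
  open FiniteField 𝔽
  open CommutativeRing commutativeRing using (1#)
  open FlagRank 𝔽
  open Configuration C
  open FiniteFieldLinearAlgebra 𝔽
  open FlagRankBounds 𝔽 1<q
  open Code 𝔽 1<q C
  open MinimumDistance 𝔽 1<q C
  open Dimension 𝔽 1<q
  open LinearAlgebra (Mat (2 + k) (2 + k))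

  linear : IsLinearCode (𝒟 C)
  linear = record
    { resp     = λ A≈B A∈𝒟 → 𝒦⊆𝒟 (IsSubspace.resp 𝒦-isSubspace A≈B (𝒟⊆𝒦 A∈𝒟))
    ; 0-closed = 𝒦⊆𝒟 (IsSubspace.0-closed 𝒦-isSubspace)
    ; +-closed = λ A∈𝒟 B∈𝒟 → 𝒦⊆𝒟 (IsSubspace.+-closed 𝒦-isSubspace (𝒟⊆𝒦 A∈𝒟) (𝒟⊆𝒦 B∈𝒟))
    ; *-closed = λ s A∈𝒟 → 𝒦⊆𝒟 (IsSubspace.*-closed 𝒦-isSubspace s (𝒟⊆𝒦 A∈𝒟))
    } , λ A∈𝒟 → proj₁ (𝒟⊆𝒦 A∈𝒟)

  -- The matrix unit at (0, 0) has weight at most 1, too small for a nonzero codeword.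
  nontrivial : IsNonTrivial (𝒟 C)
  nontrivial (_ , U⊆𝒟) = ℕ.<⇒≱ (s≤s (s≤s z≤n)) (ℕ.≤-trans
    (minimum-weight (𝒟⊆𝒦 (U⊆𝒟 (E∈U zero zero 1# z≤n))) (Eᵢⱼ≉0 zero zero 1≉0))
    (fr-E-bound [ zero ]-injective zero zero 1# λ k k∉ (_ , k≤0) →
      k∉ zero (Fin.toℕ-injective (≡.sym (ℕ.n≤0⇒n≡0 k≤0)))))

  -- The matrix unit at (0, 2) attains the bound: it lies above the superdiagonal, so its syndrome
  -- is zero, and it meets only the blocks 0, 1 and 2.
  minimumDistance : HasMinimumDistance (𝒟 C) 3
  minimumDistance =
    (light , 𝒦⊆𝒟 light∈𝒦 , light≉0 , ℕ.≤-antisym fr≤3 (minimum-weight light∈𝒦 light≉0)) ,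
    (λ M M∈𝒟 M≉0 → minimum-weight (𝒟⊆𝒦 M∈𝒟) M≉0)
    where
    two : Fin (2 + k)
    two = fromℕ< 3≤n

    light : Matrix (2 + k) (2 + k)
    light = E zero two 1#

    toℕ-two : toℕ two ≡ 2
    toℕ-two = Fin.toℕ-fromℕ< 3≤n

    light∈𝒦 : light ∈ 𝒦
    light∈𝒦 = far-E∈𝒦 zero two 1# (ℕ.≤-reflexive (≡.sym toℕ-two))

    light≉0 = Eᵢⱼ≉0 zero two 1≉0

    fr≤3 : fr light ≤ 3
    fr≤3 = fr-E-bound (triple-injective {x = zero} {suc zero} {two} (λ ())
      (λ eq → contradiction (≡.trans (≡.cong toℕ eq) toℕ-two) λ ())
      (λ eq → contradiction (≡.trans (≡.cong toℕ eq) toℕ-two) λ ()))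
      zero two 1# λ where
        zero          k∉ _ → k∉ zero ≡.refl
        (suc zero)    k∉ _ → k∉ (suc zero) ≡.refl
        (suc (suc i)) k∉ (_ , i≤2) → k∉ (suc (suc zero)) (Fin.toℕ-injective
          (ℕ.≤-antisym (≡.subst (_≤ 2 + toℕ i) (≡.sym toℕ-two) (ℕ.m≤m+n 2 (toℕ i))) i≤2))

  codimension : HasCodimension (𝒟 C) 3
  codimension = freeCount k , 𝒟-dimension C , freeCount+3 k

  -- For distance 3 the radius `(3 ∸ 1) / 2` computes to 1, so `ball-size` applies; the ball then
  -- has `q ^ 3` elements, which makes up for the codimension 3.
  perfect : ∀ {q′} → 2 + k ≡ q ^ 2 + q + 1 → q ≡ suc q′ → IsPerfect (𝒟 C)
  perfect {q′} n≡ q≡ = 3 , minimumDistance , q ^ freeCount k , suc ((2 + k) * q′) ,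
    dimension⇒size (Mat (2 + k) (2 + k)) (𝒟-dimension C) , ball-size q≡ , (begin
      q ^ freeCount k * suc ((2 + k) * q′)    ≡⟨ ≡.cong (q ^ freeCount k *_) (sphere-packing n≡ q≡) ⟩
      q ^ freeCount k * q ^ 3                 ≡⟨ ℕ.^-distribˡ-+-* q (freeCount k) 3 ⟨
      q ^ (freeCount k + 3)                   ≡⟨ ≡.cong (q ^_) (freeCount+3 k) ⟨
      q ^ ((2 + k) * suc (2 + k) / 2)         ∎)
    where open ≡.≡-Reasoning

theorem5p8 : ∀ {c ℓ₁ ℓ₂} (q : ℕ) → IsPrimePower q →
    (𝔽 : FiniteField c ℓ₁ ℓ₂ q) → let open FlagRank 𝔽 in
    (m : ℕ) → suc m ≡ q ^ 2 + q + 1 → (C : Configuration m) →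
    IsLinearCode (𝒟 C) ×
    IsNonTrivial (𝒟 C) ×
    IsPerfect (𝒟 C) ×
    HasMinimumDistance (𝒟 C) 3 ×
    HasCodimension (𝒟 C) 3
-- Since 3 ≤ n, the size can be written as `2 + k`, which exposes the two columns of the corner.
theorem5p8 q q-pp 𝔽 zero n≡ C with s≤s () ← FlagRank.Configuration.3≤n C
theorem5p8 zero q-pp 𝔽 (suc k) n≡ C with () ← primePower>1 q-pp
theorem5p8 (suc q′) q-pp 𝔽 (suc k) n≡ C =
  linear , nontrivial , perfect n≡ ≡.refl , minimumDistance , codimension
  where open Parameters 𝔽 (primePower>1 q-pp) C
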